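{- Let $p$ be an odd prime, $B_k$ the Bernoulli numbers (with $B_1=-\tfrac12$), $\mathcal{B}_k=B_k/k$ for $k\ge1$, $w_p=\frac{(p-1)!+1}{p}$ the Wilson quotient, $q_p(2)=\frac{2^{p-1}-1}{p}$ the Fermat quotient, and $H_n=\sum_{j=1}^n\frac1j$. Then, modulo $p$: $$\sum_{k=1}^{p-2}\mathcal{B}_k\equiv\frac{pB_{p-1}+1}{p}-1\equiv w_p,$$ $$\sum_{k=1}^{p-2}\frac{\mathcal{B}_k}{2^k}\equiv q_p(2)+w_p,$$ $$\sum_{k=1}^{p-2}\frac{\mathcal{B}_k}{2^k}\equiv-\frac12H_{\frac{p-1}{2}}+\frac{pB_{p-1}+1}{p}-1,$$ $$\sum_{\substack{1\le k\le p-2\\ k\text{ even}}}\frac{B_k}{k\,2^k}\equiv\frac34+\sum_{\substack{1\le k\le p-2\\ k\text{ even}}}\frac{B_k-1}{k}.$$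
   Context: Congruences are taken in $\mathbb{Z}_p$; $\frac{pB_{p-1}+1}{p}\in\mathbb{Z}_p$. -}

module Defs where

open import Data.Nat as ℕ using (ℕ; zero; suc; _∸_; _^_)
open import Data.Nat.Combinatorics using (_C_)
open import Data.Nat.Divisibility using (_∣_)
open import Data.Integer as ℤ using (ℤ; +_)
open import Data.Rational as ℚ using (ℚ; _+_; _*_; _-_; -_; 0ℚ; 1ℚ)
open import Data.List using (List; []; _∷_; _++_; length; sum; map; upTo; zip; foldr)
open import Data.Bool using (Bool; true; false; if_then_else_)
open import Data.Product using (_×_)
open import Relation.Nullary using (¬_)

-- 1/n as a rational, for n ≥ 1 (convention: recip 0 = 0; only used with n ≥ 1)
recip : ℕ → ℚ
recip zero = 0ℚ
recip (suc n) = + 1 ℚ./ suc n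

_÷ₙ_ : ℚ → ℕ → ℚ
x ÷ₙ n = x * recip n

ℕtoℚ : ℕ → ℚ
ℕtoℚ n = + n ℚ./ 1

Σ₁ : ℕ → (ℕ → ℚ) → ℚ
Σ₁ zero f = 0ℚ
Σ₁ (suc n) f = Σ₁ n f + f (suc n)

-- Bernoulli numbers with B₁ = -1/2, via  B_m = -(1/(m+1)) ∑_{k<m} C(m+1,k) B_k.
-- nextB bs, where bs = [B_0,…,B_{m-1}], computes B_m.
nextB : List ℚ → ℚ
nextB bs = - (go 0 bs ÷ₙ suc m)
  where
  m = length bs
  go : ℕ → List ℚ → ℚ
  go k [] = 0ℚ
  go k (b ∷ rest) = ℕtoℚ (suc m C k) * b + go (suc k) rest

bernoulli : ℕ → ℚ
bernList : ℕ → List ℚ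
bernList zero = []
bernList (suc n) = bernList n ++ (bernoulli n ∷ [])

-- B_n  (B_0 = 1; for m ≥ 1 the recurrence ∑_{k=0}^{m} C(m+1,k) B_k = 0)
bernoulli zero = 1ℚ
bernoulli (suc n) = nextB (bernList (suc n))

modB : ℕ → ℚ
modB k = bernoulli k ÷ₙ k

harmonic : ℕ → ℚ
harmonic n = Σ₁ n recip

wilsonQ : ℕ → ℚ
wilsonQ p = ℕtoℚ ((p ∸ 1) ℕ.! ℕ.+ 1) ÷ₙ p

fermatQ2 : ℕ → ℚ
fermatQ2 p = (ℕtoℚ (2 ^ (p ∸ 1)) - 1ℚ) ÷ₙ p

bernQ : ℕ → ℚ
bernQ p = (ℕtoℚ p * bernoulli (p ∸ 1) + 1ℚ) ÷ₙ p

isEven : ℕ → Bool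
isEven zero = true
isEven (suc n) = if isEven n then false else true

-- congruence modulo p in ℤ_p for rationals: x - y = p·c with c p-integral,
-- i.e. in lowest terms p divides the numerator and not the denominator of x - y.
infix 4 _≡_[modₚ_]
_≡_[modₚ_] : ℚ → ℚ → ℕ → Set
x ≡ y [modₚ p ] = (p ∣ ℤ.∣ ℚ.↥ (x - y) ∣) × ¬ (p ∣ ℚ.↧ₙ (x - y))

{-# OPTIONS --safe #-}
-- Umbrally (𝐁 + 1)ⁿ = 𝐁ⁿ + [n = 1], so that (𝐁 + x)ᵖ = 𝐁ᵖ + p (1ᵖ⁻¹ + … + (x - 1)ᵖ⁻¹) for x ∈ ℕ.
-- Since C p k / p ≡ (-1)ᵏ⁻¹ / k and (-1)ᵏ Bₖ = Bₖ + [k = 1], expanding the left-hand side at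
-- x = 1 and x = 2 and dividing by p evaluates the first two sums in terms of p B₍p₋₁₎ and q_p(2).
-- At x = p it gives 1ᵖ⁻¹ + … + (p - 1)ᵖ⁻¹ ≡ p B₍p₋₁₎ modulo p²; the same power sum is compared with
-- (p - 1)! by writing the latter as the (p - 1)-st difference of kᵖ⁻¹ and expanding
-- (-1)ᵏ C (p - 1) k ≡ 1 - p Hₖ modulo p².  The harmonic number enters through
-- 2 q_p(2) = Σ C p k / p ≡ - Σ (-1)ᵏ / k, and the sums over even k through 1 + (-1)ᵏ.
module Submission where

open import Defs
open import Data.Nat as ℕ using (ℕ; zero; suc; _∸_; _^_; _*_; ⌊_/2⌋; _≤_; _<_; z≤n; s≤s)
import Data.Nat.Properties as ℕ
open import Data.Nat.Combinatorics using (_C_; nCn≡1; nC1≡n; nCk≡nC[n∸k]; k>n⇒nCk≡0; nCk+nC[k+1]≡[n+1]C[k+1])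
open import Data.Nat.Divisibility using (_∣_; divides; >⇒∤; ∣1⇒≡1)
open import Data.Nat.Primality using (Prime; euclidsLemma; prime⇒nonZero; prime⇒irreducible; ¬prime[1])
open import Data.Integer as ℤ using (ℤ; +_)
import Data.Integer.Properties as ℤ
open import Data.Rational as ℚ using (ℚ; _+_; _-_; -_; 0ℚ; 1ℚ; _/_) renaming (_*_ to _·_)
import Data.Rational.Properties as ℚ
open import Data.Rational.Unnormalised as ℚᵘ using (mkℚᵘ; *≡*; _≃_)
import Data.Rational.Unnormalised.Properties as ℚᵘ
open import Data.Bool using (if_then_else_; true; false)
open import Data.List using (List; []; _∷_; length; _++_)
import Data.List.Properties as List
open import Data.Product using (_×_; _,_; ∃)
open import Data.Sum using (_⊎_; inj₁; inj₂; [_,_]′)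
open import Data.Empty using (⊥-elim-irr)
open import Relation.Nullary using (¬_; contradiction)
open import Relation.Nullary.Decidable using (dec⇒maybe)
open import Relation.Binary.PropositionalEquality using (_≡_; _≢_; refl; sym; trans; cong; cong₂; subst; module ≡-Reasoning)
open import Relation.Binary.Bundles using (Setoid)
open import Relation.Binary.Structures using (IsEquivalence)
open import Function using (id)
import Relation.Binary.Reasoning.Setoid as SetoidReasoning
open import Algebra.Bundles using (CommutativeRing)
open import Algebra.Properties.Semiring.Exp (CommutativeRing.semiring ℚ.+-*-commutativeRing) using () renaming (_^_ to _↑_)
open import Tactic.RingSolver using (solve-∀)
open import Tactic.RingSolver.Core.AlmostCommutativeRing using (AlmostCommutativeRing; fromCommutativeRing)

-- The obstacle is B₍p₋₁₎, which is not p-integral and yet occurs in each expansion at x = 1, 2 and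
-- p. The umbral identities are therefore kept exact in that term: B₍p₋₁₎ is either absorbed into (p
-- B₍p₋₁₎ + 1) / p or carried along as p B₍p₋₁₎, and only the sums over k ≤ p - 2, whose Bernoulli
-- numbers are p-integral, are reduced modulo p. For the same reason a congruence asks integrality
-- of the quotient (x - y) / m, not of x and y. The Wilson quotient divides by p, so (p - 1)! must
-- be known modulo p². Writing it as a difference gives this precision: its signed coefficients are
-- products of factors 1 - p / j, hence known modulo p². The power kᵖ⁻¹ is then needed modulo p²
-- only in the power sum, where Bernoulli numbers re-enter; next to p Hₖ it matters only modulo p,
-- where Fermat's theorem makes it 1.

ring : AlmostCommutativeRing _ _
ring = fromCommutativeRing ℚ.+-*-commutativeRing (λ x → dec⇒maybe (0ℚ ℚ.≟ x))

-- Integers, reciprocals and denominators in ℚ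

fromℤ : ℤ → ℚ
fromℤ i = i / 1

toℚᵘ-fromℤ : ∀ i → ℚ.toℚᵘ (fromℤ i) ≃ mkℚᵘ i 0
toℚᵘ-fromℤ i = ℚ.toℚᵘ-fromℚᵘ (mkℚᵘ i 0)

fromℤ-+ : ∀ i j → fromℤ (i ℤ.+ j) ≡ fromℤ i + fromℤ j
fromℤ-+ i j = ℚ.toℚᵘ-injective (begin
  ℚ.toℚᵘ (fromℤ (i ℤ.+ j))                  ≈⟨ toℚᵘ-fromℤ (i ℤ.+ j) ⟩
  mkℚᵘ (i ℤ.+ j) 0                           ≈⟨ *≡* (cong (ℤ._* + 1) (cong₂ ℤ._+_ (ℤ.*-identityʳ i) (ℤ.*-identityʳ j))) ⟨
  mkℚᵘ i 0 ℚᵘ.+ mkℚᵘ j 0                     ≈⟨ ℚᵘ.+-cong (toℚᵘ-fromℤ i) (toℚᵘ-fromℤ j) ⟨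
  ℚ.toℚᵘ (fromℤ i) ℚᵘ.+ ℚ.toℚᵘ (fromℤ j)    ≈⟨ ℚ.toℚᵘ-homo-+ (fromℤ i) (fromℤ j) ⟨
  ℚ.toℚᵘ (fromℤ i + fromℤ j)                ∎)
  where open ℚᵘ.≃-Reasoning

fromℤ-* : ∀ i j → fromℤ (i ℤ.* j) ≡ fromℤ i · fromℤ j
fromℤ-* i j = ℚ.toℚᵘ-injective (begin
  ℚ.toℚᵘ (fromℤ (i ℤ.* j))                  ≈⟨ toℚᵘ-fromℤ (i ℤ.* j) ⟩
  mkℚᵘ i 0 ℚᵘ.* mkℚᵘ j 0                     ≈⟨ ℚᵘ.*-cong (toℚᵘ-fromℤ i) (toℚᵘ-fromℤ j) ⟨
  ℚ.toℚᵘ (fromℤ i) ℚᵘ.* ℚ.toℚᵘ (fromℤ j)    ≈⟨ ℚ.toℚᵘ-homo-* (fromℤ i) (fromℤ j) ⟨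
  ℚ.toℚᵘ (fromℤ i · fromℤ j)                ∎)
  where open ℚᵘ.≃-Reasoning

fromℤ-neg : ∀ i → fromℤ (ℤ.- i) ≡ - fromℤ i
fromℤ-neg i = trans (inverse (fromℤ i) (fromℤ (ℤ.- i))) (trans (cong (_- fromℤ i) (trans (sym (fromℤ-+ i (ℤ.- i))) (cong fromℤ (ℤ.+-inverseʳ i)))) (ℚ.+-identityˡ _))
  where
  inverse : ∀ x y → y ≡ (x + y) - x
  inverse = solve-∀ ring

fromℤ-injective : ∀ {i j} → fromℤ i ≡ fromℤ j → i ≡ j
fromℤ-injective {i} {j} eq with ℚᵘ.≃-trans (ℚᵘ.≃-sym (toℚᵘ-fromℤ i)) (ℚᵘ.≃-trans (ℚᵘ.≃-reflexive (cong ℚ.toℚᵘ eq)) (toℚᵘ-fromℤ j))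
... | *≡* i*1≡j*1 = trans (sym (ℤ.*-identityʳ i)) (trans i*1≡j*1 (ℤ.*-identityʳ j))

ℕtoℚ-+ : ∀ m n → ℕtoℚ (m ℕ.+ n) ≡ ℕtoℚ m + ℕtoℚ n
ℕtoℚ-+ m n = fromℤ-+ (+ m) (+ n)

ℕtoℚ-suc : ∀ n → ℕtoℚ (suc n) ≡ 1ℚ + ℕtoℚ n
ℕtoℚ-suc n = ℕtoℚ-+ 1 n

ℕtoℚ-* : ∀ m n → ℕtoℚ (m * n) ≡ ℕtoℚ m · ℕtoℚ n
ℕtoℚ-* m n = trans (cong fromℤ (ℤ.pos-* m n)) (fromℤ-* (+ m) (+ n))

ℕtoℚ-^ : ∀ m n → ℕtoℚ (m ^ n) ≡ ℕtoℚ m ↑ n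
ℕtoℚ-^ m zero    = refl
ℕtoℚ-^ m (suc n) = trans (ℕtoℚ-* m (m ^ n)) (cong (ℕtoℚ m ·_) (ℕtoℚ-^ m n))

recip-inverse : ∀ n → recip (suc n) · ℕtoℚ (suc n) ≡ 1ℚ
recip-inverse n = ℚ.toℚᵘ-injective (begin
  ℚ.toℚᵘ (recip (suc n) · ℕtoℚ (suc n))                ≈⟨ ℚ.toℚᵘ-homo-* (recip (suc n)) (ℕtoℚ (suc n)) ⟩
  ℚ.toℚᵘ (recip (suc n)) ℚᵘ.* ℚ.toℚᵘ (ℕtoℚ (suc n))    ≈⟨ ℚᵘ.*-cong (ℚ.toℚᵘ-fromℚᵘ (mkℚᵘ (+ 1) n)) (toℚᵘ-fromℤ (+ suc n)) ⟩
  mkℚᵘ (+ 1) n ℚᵘ.* mkℚᵘ (+ suc n) 0                    ≈⟨ *≡* (trans (ℤ.*-identityʳ _) (cong (ℤ._*_ (+ 1)) (cong +_ (sym (ℕ.*-identityʳ (suc n)))))) ⟩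
  ℚ.toℚᵘ 1ℚ                                            ∎)
  where open ℚᵘ.≃-Reasoning

cancelʳ : ∀ n {x y} → x · ℕtoℚ (suc n) ≡ y · ℕtoℚ (suc n) → x ≡ y
cancelʳ n {x} {y} eq = trans (expand x) (trans (cong (_· recip (suc n)) eq) (sym (expand y)))
  where
  assoc : ∀ x r k → x · (r · k) ≡ x · k · r
  assoc = solve-∀ ring
  expand : ∀ x → x ≡ x · ℕtoℚ (suc n) · recip (suc n)
  expand x = trans (sym (ℚ.*-identityʳ x)) (trans (cong (x ·_) (sym (recip-inverse n))) (assoc x _ _))

-- Links the lowest-terms fraction, in which the final congruences are phrased, to equations between
-- products, in which integrality is proved.
denominator-clears : ∀ x → x · ℕtoℚ (ℚ.↧ₙ x) ≡ fromℤ (ℚ.↥ x)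
denominator-clears x@(ℚ.mkℚ n d-1 _) = ℚ.toℚᵘ-injective (begin
  ℚ.toℚᵘ (x · ℕtoℚ (suc d-1))                ≈⟨ ℚ.toℚᵘ-homo-* x (ℕtoℚ (suc d-1)) ⟩
  mkℚᵘ n d-1 ℚᵘ.* ℚ.toℚᵘ (ℕtoℚ (suc d-1))    ≈⟨ ℚᵘ.*-congˡ {mkℚᵘ n d-1} (toℚᵘ-fromℤ (+ suc d-1)) ⟩
  mkℚᵘ n d-1 ℚᵘ.* mkℚᵘ (+ suc d-1) 0          ≈⟨ *≡* (trans (ℤ.*-identityʳ _) (cong (ℤ._*_ n) (cong +_ (sym (ℕ.*-identityʳ (suc d-1)))))) ⟩
  mkℚᵘ n 0                                   ≈⟨ toℚᵘ-fromℤ n ⟨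
  ℚ.toℚᵘ (fromℤ n)                           ∎)
  where open ℚᵘ.≃-Reasoning

-- Finite sums and binomial coefficients

Σ₁-cong : ∀ n {f g : ℕ → ℚ} → (∀ k → k < n → f (suc k) ≡ g (suc k)) → Σ₁ n f ≡ Σ₁ n g
Σ₁-cong zero    f≡g = refl
Σ₁-cong (suc n) f≡g = cong₂ _+_ (Σ₁-cong n λ k k<n → f≡g k (ℕ.m<n⇒m<1+n k<n)) (f≡g n ℕ.≤-refl)

Σ₁-+ : ∀ n (f g : ℕ → ℚ) → Σ₁ n (λ k → f k + g k) ≡ Σ₁ n f + Σ₁ n g
Σ₁-+ zero    f g = refl
Σ₁-+ (suc n) f g = trans (cong (_+ (f (suc n) + g (suc n))) (Σ₁-+ n f g)) (interchange (Σ₁ n f) (Σ₁ n g) (f (suc n)) (g (suc n)))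
  where
  interchange : ∀ a b c d → (a + b) + (c + d) ≡ (a + c) + (b + d)
  interchange = solve-∀ ring

Σ₁-* : ∀ n c (f : ℕ → ℚ) → Σ₁ n (λ k → c · f k) ≡ c · Σ₁ n f
Σ₁-* zero    c f = sym (ℚ.*-zeroʳ c)
Σ₁-* (suc n) c f = trans (cong (_+ c · f (suc n)) (Σ₁-* n c f)) (sym (ℚ.*-distribˡ-+ c (Σ₁ n f) (f (suc n))))

Σ₁-neg : ∀ n (f : ℕ → ℚ) → Σ₁ n (λ k → - f k) ≡ - Σ₁ n f
Σ₁-neg zero    f = refl
Σ₁-neg (suc n) f = trans (cong (_+ - f (suc n)) (Σ₁-neg n f)) (sym (ℚ.neg-distrib-+ (Σ₁ n f) (f (suc n))))

Σ₁-zero : ∀ n {f : ℕ → ℚ} → (∀ k → k < n → f (suc k) ≡ 0ℚ) → Σ₁ n f ≡ 0ℚ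
Σ₁-zero zero    f≡0 = refl
Σ₁-zero (suc n) f≡0 = cong₂ _+_ (Σ₁-zero n λ k k<n → f≡0 k (ℕ.m<n⇒m<1+n k<n)) (f≡0 n ℕ.≤-refl)

Σ₁-head : ∀ n (f : ℕ → ℚ) → Σ₁ (suc n) f ≡ f 1 + Σ₁ n (λ k → f (suc k))
Σ₁-head zero    f = ℚ.+-comm 0ℚ (f 1)
Σ₁-head (suc n) f = trans (cong (_+ f (suc (suc n))) (Σ₁-head n f)) (ℚ.+-assoc (f 1) (Σ₁ n (λ k → f (suc k))) (f (suc (suc n))))

nC0≡1 : ∀ n → n C 0 ≡ 1
nC0≡1 n = trans (nCk≡nC[n∸k] {n = n} z≤n) (nCn≡1 n)

[1+n]Cn≡1+n : ∀ n → suc n C n ≡ suc n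
[1+n]Cn≡1+n n = trans (nCk≡nC[n∸k] (ℕ.n≤1+n n)) (trans (cong (suc n C_) (ℕ.m+n∸n≡m 1 n)) (nC1≡n (suc n)))

pascal : ∀ n k → ℕtoℚ (suc n C suc k) ≡ ℕtoℚ (n C k) + ℕtoℚ (n C suc k)
pascal n k = trans (cong ℕtoℚ (sym (nCk+nC[k+1]≡[n+1]C[k+1] n k))) (ℕtoℚ-+ (n C k) (n C suc k))

-- Umbral calculus

-- The umbral power (x + a)ⁿ, in which aᵏ is read as the k-th term of the sequence.
umbral : ℚ → (ℕ → ℚ) → ℕ → ℚ
umbral x a zero    = a zero
umbral x a (suc n) = x · umbral x a n + umbral x (λ k → a (suc k)) n

-- The binomial theorem. The term k = 0 stands apart because `Σ₁` starts at 1.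
umbral-expand : ∀ x a n →
  umbral x a n ≡ x ↑ n · a 0 + Σ₁ n (λ k → ℕtoℚ (n C k) · x ↑ (n ∸ k) · a k)
umbral-expand x a zero = unit (a 0)
  where
  unit : ∀ y → y ≡ 1ℚ · y + 0ℚ
  unit = solve-∀ ring
umbral-expand x a (suc n) = begin
  x · umbral x a n + umbral x (λ k → a (suc k)) n
    ≡⟨ cong₂ (λ y z → x · y + z) (umbral-expand x a n) (umbral-expand x (λ k → a (suc k)) n) ⟩
  x · (x ↑ n · a 0 + Σ₁ n (λ k → ℕtoℚ (n C k) · x ↑ (n ∸ k) · a k)) + (x ↑ n · a 1 + Σ₁ n u)
    ≡⟨ cong₂ (λ y z → x · (x ↑ n · a 0 + Σ₁ n (λ k → ℕtoℚ (n C k) · x ↑ (n ∸ k) · a k)) + (y + z)) u₀ refl ⟨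
  x · (x ↑ n · a 0 + Σ₁ n (λ k → ℕtoℚ (n C k) · x ↑ (n ∸ k) · a k)) + (u 0 + Σ₁ n u)
    ≡⟨ regroup x (x ↑ n) (a 0) _ _ ⟩
  x ↑ suc n · a 0 + ((u 0 + Σ₁ n u) + x · Σ₁ n (λ k → ℕtoℚ (n C k) · x ↑ (n ∸ k) · a k))
    ≡⟨ cong (λ y → x ↑ suc n · a 0 + (y + x · Σ₁ n (λ k → ℕtoℚ (n C k) · x ↑ (n ∸ k) · a k))) (sym (Σ₁-head n (λ k → u (k ∸ 1)))) ⟩
  x ↑ suc n · a 0 + (Σ₁ (suc n) (λ k → u (k ∸ 1)) + x · Σ₁ n (λ k → ℕtoℚ (n C k) · x ↑ (n ∸ k) · a k))
    ≡⟨ cong (λ y → x ↑ suc n · a 0 + (Σ₁ (suc n) (λ k → u (k ∸ 1)) + y)) w-sum ⟨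
  x ↑ suc n · a 0 + (Σ₁ (suc n) (λ k → u (k ∸ 1)) + Σ₁ (suc n) w)
    ≡⟨ cong (_+_ (x ↑ suc n · a 0)) (Σ₁-+ (suc n) (λ k → u (k ∸ 1)) w) ⟨
  x ↑ suc n · a 0 + Σ₁ (suc n) (λ k → u (k ∸ 1) + w k)
    ≡⟨ cong (_+_ (x ↑ suc n · a 0)) (Σ₁-cong (suc n) λ k _ → u+w k) ⟩
  x ↑ suc n · a 0 + Σ₁ (suc n) (λ k → ℕtoℚ (suc n C k) · x ↑ (suc n ∸ k) · a k) ∎
  where
  open ≡-Reasoning
  -- `u` collects the terms of the shifted sequence, to be moved up by one index, and `w` those
  -- multiplied by `x`; Pascal's rule adds `u k` to `w (suc k)`. Running `w` up to n + 1 costs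
  -- nothing, since C n (n + 1) = 0.
  u w : ℕ → ℚ
  u k = ℕtoℚ (n C k) · x ↑ (n ∸ k) · a (suc k)
  w k = ℕtoℚ (n C k) · x ↑ (suc n ∸ k) · a k

  u₀ : u 0 ≡ x ↑ n · a 1
  u₀ = cong (_· a 1) (trans (cong (λ c → ℕtoℚ c · x ↑ n) (nC0≡1 n)) (ℚ.*-identityˡ (x ↑ n)))

  regroup : ∀ x y b s t → x · (y · b + s) + t ≡ x · y · b + (t + x · s)
  regroup = solve-∀ ring

  distrib : ∀ c d y b → c · y · b + d · y · b ≡ (c + d) · y · b
  distrib = solve-∀ ring

  u+w : ∀ k → u k + w (suc k) ≡ ℕtoℚ (suc n C suc k) · x ↑ (n ∸ k) · a (suc k)
  u+w k = trans (distrib (ℕtoℚ (n C k)) (ℕtoℚ (n C suc k)) (x ↑ (n ∸ k)) (a (suc k))) (cong (λ c → c · x ↑ (n ∸ k) · a (suc k)) (sym (pascal n k)))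

  pull : ∀ c x y b → c · (x · y) · b ≡ x · (c · y · b)
  pull = solve-∀ ring

  w-last : w (suc n) ≡ 0ℚ
  w-last = trans (cong (λ c → ℕtoℚ c · x ↑ (n ∸ n) · a (suc n)) (k>n⇒nCk≡0 (ℕ.n<1+n n)))
    (trans (cong (_· a (suc n)) (ℚ.*-zeroˡ (x ↑ (n ∸ n)))) (ℚ.*-zeroˡ (a (suc n))))

  w-sum : Σ₁ (suc n) w ≡ x · Σ₁ n (λ k → ℕtoℚ (n C k) · x ↑ (n ∸ k) · a k)
  w-sum = trans (cong₂ _+_
    (trans (Σ₁-cong n λ k k<n → trans (cong (λ e → ℕtoℚ (n C suc k) · x ↑ e · a (suc k)) (ℕ.+-∸-assoc 1 k<n)) (pull (ℕtoℚ (n C suc k)) x (x ↑ (n ∸ suc k)) (a (suc k))))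
           (Σ₁-* n x (λ k → ℕtoℚ (n C k) · x ↑ (n ∸ k) · a k))) w-last) (ℚ.+-identityʳ (x · Σ₁ n (λ k → ℕtoℚ (n C k) · x ↑ (n ∸ k) · a k)))

umbral-cong : ∀ x {a b : ℕ → ℚ} → (∀ k → a k ≡ b k) → ∀ n → umbral x a n ≡ umbral x b n
umbral-cong x a≡b zero    = a≡b zero
umbral-cong x a≡b (suc n) = cong₂ (λ y z → x · y + z) (umbral-cong x a≡b n) (umbral-cong x (λ k → a≡b (suc k)) n)

umbral-+ : ∀ x a b n → umbral x (λ k → a k + b k) n ≡ umbral x a n + umbral x b n
umbral-+ x a b zero    = refl
umbral-+ x a b (suc n) = trans
  (cong₂ (λ y z → x · y + z) (umbral-+ x a b n) (umbral-+ x (λ k → a (suc k)) (λ k → b (suc k)) n))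
  (interchange x _ _ _ _)
  where
  interchange : ∀ x a b c d → x · (a + b) + (c + d) ≡ (x · a + c) + (x · b + d)
  interchange = solve-∀ ring

umbral-* : ∀ x c a n → umbral x (λ k → c · a k) n ≡ c · umbral x a n
umbral-* x c a zero    = refl
umbral-* x c a (suc n) = trans
  (cong₂ (λ y z → x · y + z) (umbral-* x c a n) (umbral-* x c (λ k → a (suc k)) n)) (pull x c _ _)
  where
  pull : ∀ x c a b → x · (c · a) + c · b ≡ c · (x · a + b)
  pull = solve-∀ ring

-- Composition serves twice: translations by 1 and -1 cancel, which inverts a binomial transform,
-- and repeated translation by 1 reaches every natural number.
umbral-∘ : ∀ x y a n → umbral x (umbral y a) n ≡ umbral (x + y) a n
umbral-∘ x y a zero    = refl
umbral-∘ x y a (suc n) = begin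
  x · umbral x (umbral y a) n + umbral x (λ k → y · umbral y a k + umbral y a⁺ k) n
    ≡⟨ cong (_+_ (x · umbral x (umbral y a) n)) (trans (umbral-+ x (λ k → y · umbral y a k) (umbral y a⁺) n)
         (cong (_+ umbral x (umbral y a⁺) n) (umbral-* x y (umbral y a) n))) ⟩
  x · umbral x (umbral y a) n + (y · umbral x (umbral y a) n + umbral x (umbral y a⁺) n)
    ≡⟨ regroup x y _ _ ⟩
  (x + y) · umbral x (umbral y a) n + umbral x (umbral y a⁺) n
    ≡⟨ cong₂ (λ s t → (x + y) · s + t) (umbral-∘ x y a n) (umbral-∘ x y a⁺ n) ⟩
  (x + y) · umbral (x + y) a n + umbral (x + y) a⁺ n ∎
  where
  open ≡-Reasoning
  a⁺ : ℕ → ℚ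
  a⁺ k = a (suc k)
  regroup : ∀ x y s t → x · s + (y · s + t) ≡ (x + y) · s + t
  regroup = solve-∀ ring

umbral-0 : ∀ a n → umbral 0ℚ a n ≡ a n
umbral-0 a zero    = refl
umbral-0 a (suc n) = trans (cong₂ _+_ (ℚ.*-zeroˡ (umbral 0ℚ a n)) (umbral-0 (λ k → a (suc k)) n)) (ℚ.+-identityˡ (a (suc n)))

umbral-1 : ∀ x n → umbral x (λ _ → 1ℚ) n ≡ (x + 1ℚ) ↑ n
umbral-1 x zero    = refl
umbral-1 x (suc n) = trans (factor x _) (cong ((x + 1ℚ) ·_) (umbral-1 x n))
  where
  factor : ∀ x u → x · u + u ≡ (x + 1ℚ) · u
  factor = solve-∀ ring

sgn : ℕ → ℚ
sgn n = (- 1ℚ) ↑ n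

sgn² : ∀ n → sgn n · sgn n ≡ 1ℚ
sgn² zero    = refl
sgn² (suc n) = trans (square (sgn n)) (sgn² n)
  where
  square : ∀ s → (- 1ℚ · s) · (- 1ℚ · s) ≡ s · s
  square = solve-∀ ring

sgn-∸ : ∀ n k → k ≤ n → sgn (n ∸ k) ≡ sgn n · sgn k
sgn-∸ n       zero    z≤n       = sym (ℚ.*-identityʳ (sgn n))
sgn-∸ (suc n) (suc k) (s≤s k≤n) = trans (sgn-∸ n k k≤n) (flip (sgn n) (sgn k))
  where
  flip : ∀ s t → s · t ≡ (- 1ℚ · s) · (- 1ℚ · t)
  flip = solve-∀ ring

-- The sign is distributed as -(x + a) = -x + (-a), where the umbra -a has the powers (-1)ᵏ aᵏ.
sgn-umbral : ∀ x a n → sgn n · umbral x a n ≡ umbral (- x) (λ k → sgn k · a k) n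
sgn-umbral x a zero    = refl
sgn-umbral x a (suc n) = begin
  - 1ℚ · sgn n · (x · umbral x a n + umbral x a⁺ n)
    ≡⟨ expand x (sgn n) _ _ ⟩
  - x · (sgn n · umbral x a n) + - 1ℚ · (sgn n · umbral x a⁺ n)
    ≡⟨ cong₂ (λ y z → - x · y + - 1ℚ · z) (sgn-umbral x a n) (sgn-umbral x a⁺ n) ⟩
  - x · umbral (- x) (λ k → sgn k · a k) n + - 1ℚ · umbral (- x) (λ k → sgn k · a⁺ k) n
    ≡⟨ cong (_+_ (- x · umbral (- x) (λ k → sgn k · a k) n))
         (trans (umbral-cong (- x) (λ k → ℚ.*-assoc (- 1ℚ) (sgn k) (a⁺ k)) n) (umbral-* (- x) (- 1ℚ) _ n)) ⟨
  - x · umbral (- x) (λ k → sgn k · a k) n + umbral (- x) (λ k → sgn (suc k) · a⁺ k) n ∎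
  where
  open ≡-Reasoning
  a⁺ : ℕ → ℚ
  a⁺ k = a (suc k)
  expand : ∀ x s u v → - 1ℚ · s · (x · u + v) ≡ - x · (s · u) + - 1ℚ · (s · v)
  expand = solve-∀ ring

-- a ∂/∂a (x + a)ⁿ⁺¹ = (n + 1) a (x + a)ⁿ, read umbrally.
umbral-index : ∀ x a n →
  umbral x (λ k → ℕtoℚ k · a k) (suc n) ≡ ℕtoℚ (suc n) · umbral x (λ k → a (suc k)) n
umbral-index x a zero = start x (a 0) (a 1)
  where
  start : ∀ x a b → x · (0ℚ · a) + 1ℚ · b ≡ 1ℚ · b
  start = solve-∀ ring
umbral-index x a (suc n) = begin
  x · umbral x (λ k → ℕtoℚ k · a k) (suc n) + umbral x (λ k → ℕtoℚ (suc k) · a⁺ k) (suc n)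
    ≡⟨ cong₂ (λ y z → x · y + z) (umbral-index x a n) split ⟩
  x · (ℕtoℚ (suc n) · umbral x a⁺ n) + (ℕtoℚ (suc n) · umbral x (λ k → a⁺ (suc k)) n + umbral x a⁺ (suc n))
    ≡⟨ collect x (ℕtoℚ (suc n)) (umbral x a⁺ n) (umbral x (λ k → a⁺ (suc k)) n) ⟩
  (1ℚ + ℕtoℚ (suc n)) · umbral x a⁺ (suc n)
    ≡⟨ cong (_· umbral x a⁺ (suc n)) (ℕtoℚ-suc (suc n)) ⟨
  ℕtoℚ (suc (suc n)) · umbral x a⁺ (suc n) ∎
  where
  open ≡-Reasoning
  a⁺ : ℕ → ℚ
  a⁺ k = a (suc k)
  one-more : ∀ n a → (1ℚ + n) · a ≡ n · a + a
  one-more = solve-∀ ring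
  split : umbral x (λ k → ℕtoℚ (suc k) · a⁺ k) (suc n)
        ≡ ℕtoℚ (suc n) · umbral x (λ k → a⁺ (suc k)) n + umbral x a⁺ (suc n)
  split = trans (umbral-cong x (λ k → trans (cong (_· a⁺ k) (ℕtoℚ-suc k)) (one-more (ℕtoℚ k) (a⁺ k))) (suc n))
    (trans (umbral-+ x (λ k → ℕtoℚ k · a⁺ k) a⁺ (suc n)) (cong (_+ umbral x a⁺ (suc n)) (umbral-index x a⁺ n)))
  collect : ∀ x m u v → x · (m · u) + (m · v + (x · u + v)) ≡ (1ℚ + m) · (x · u + v)
  collect = solve-∀ ring

-- umbral (- 1ℚ) is the iterated forward difference at 0; here it is applied to k ↦ kᵐ.
differences-below : ∀ n m → m < n → umbral (- 1ℚ) (λ k → ℕtoℚ k ↑ m) n ≡ 0ℚ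
differences-below (suc n) zero    _         = trans (umbral-1 (- 1ℚ) (suc n)) (ℚ.*-zeroˡ ((- 1ℚ + 1ℚ) ↑ n))
differences-below (suc n) (suc m) (s≤s m<n) = begin
  umbral (- 1ℚ) (λ k → ℕtoℚ k · ℕtoℚ k ↑ m) (suc n)
    ≡⟨ umbral-index (- 1ℚ) (λ k → ℕtoℚ k ↑ m) n ⟩
  ℕtoℚ (suc n) · umbral (- 1ℚ) (λ k → ℕtoℚ (suc k) ↑ m) n
    ≡⟨ shift (ℕtoℚ (suc n)) (umbral (- 1ℚ) (λ k → ℕtoℚ k ↑ m) n) _ ⟩
  ℕtoℚ (suc n) · (umbral (- 1ℚ) (λ k → ℕtoℚ k ↑ m) (suc n) + umbral (- 1ℚ) (λ k → ℕtoℚ k ↑ m) n)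
    ≡⟨ cong₂ (λ y z → ℕtoℚ (suc n) · (y + z)) (differences-below (suc n) m (ℕ.m<n⇒m<1+n m<n)) (differences-below n m m<n) ⟩
  ℕtoℚ (suc n) · (0ℚ + 0ℚ)
    ≡⟨ ℚ.*-zeroʳ (ℕtoℚ (suc n)) ⟩
  0ℚ ∎
  where
  open ≡-Reasoning
  shift : ∀ m u v → m · v ≡ m · ((- 1ℚ · u + v) + u)
  shift = solve-∀ ring

-- Peeling one factor k off kⁿ⁺¹ costs a factor n + 1 and shifts the sequence. A shift is the
-- identity plus a difference, and the extra difference is of too high an order to survive.
differences-top : ∀ n → umbral (- 1ℚ) (λ k → ℕtoℚ k ↑ n) n ≡ ℕtoℚ (n ℕ.!)
differences-top zero    = refl
differences-top (suc n) = begin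
  umbral (- 1ℚ) (λ k → ℕtoℚ k · ℕtoℚ k ↑ n) (suc n)
    ≡⟨ umbral-index (- 1ℚ) (λ k → ℕtoℚ k ↑ n) n ⟩
  ℕtoℚ (suc n) · umbral (- 1ℚ) (λ k → ℕtoℚ (suc k) ↑ n) n
    ≡⟨ shift (ℕtoℚ (suc n)) (umbral (- 1ℚ) (λ k → ℕtoℚ k ↑ n) n) _ ⟩
  ℕtoℚ (suc n) · (umbral (- 1ℚ) (λ k → ℕtoℚ k ↑ n) (suc n) + umbral (- 1ℚ) (λ k → ℕtoℚ k ↑ n) n)
    ≡⟨ cong₂ (λ y z → ℕtoℚ (suc n) · (y + z)) (differences-below (suc n) n (ℕ.n<1+n n)) (differences-top n) ⟩
  ℕtoℚ (suc n) · (0ℚ + ℕtoℚ (n ℕ.!))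
    ≡⟨ cong (ℕtoℚ (suc n) ·_) (ℚ.+-identityˡ (ℕtoℚ (n ℕ.!))) ⟩
  ℕtoℚ (suc n) · ℕtoℚ (n ℕ.!)
    ≡⟨ ℕtoℚ-* (suc n) (n ℕ.!) ⟨
  ℕtoℚ (suc n ℕ.!) ∎
  where
  open ≡-Reasoning
  shift : ∀ m u v → m · v ≡ m · ((- 1ℚ · u + v) + u)
  shift = solve-∀ ring

-- Bernoulli numbers

-- Restates the local function of nextB, which cannot be named from here: its occurrences
-- are reached through the metavariables in the types below.
weightedSum : List ℚ → ℕ → List ℚ → ℚ
weightedSum full k []       = 0ℚ
weightedSum full k (b ∷ bs) = ℕtoℚ (suc (length full) C k) · b + weightedSum full (suc k) bs

mutual
  nextB-weightedSum : ∀ bs → nextB bs ≡ - (weightedSum bs 0 bs ÷ₙ suc (length bs))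
  nextB-weightedSum []       = refl
  nextB-weightedSum (b ∷ bs) =
    cong (λ w → - ((ℕtoℚ (suc (length (b ∷ bs)) C 0) · b + w) ÷ₙ suc (length (b ∷ bs)))) (nextB-tail b bs)

  nextB-tail : ∀ b bs → _ ≡ weightedSum (b ∷ bs) 1 bs
  -- Detaches the full list and the index from the list being traversed, as the induction in
  -- `nextB-go` requires.
  nextB-tail b bs with b ∷ bs | 1
  ... | full | k = nextB-go full k bs

  nextB-go : ∀ full k bs → _ ≡ weightedSum full k bs
  nextB-go full k []       = refl
  nextB-go full k (b ∷ bs) = cong (_+_ (ℕtoℚ (suc (length full) C k) · b)) (nextB-go full (suc k) bs)

weightedSum-∷ʳ : ∀ full k bs b →
  weightedSum full k (bs ++ b ∷ []) ≡ weightedSum full k bs + ℕtoℚ (suc (length full) C (k ℕ.+ length bs)) · b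
weightedSum-∷ʳ full k []        b = trans (ℚ.+-comm (ℕtoℚ (suc (length full) C k) · b) 0ℚ)
  (cong (λ i → 0ℚ + ℕtoℚ (suc (length full) C i) · b) (sym (ℕ.+-identityʳ k)))
weightedSum-∷ʳ full k (b′ ∷ bs) b = begin
  first + weightedSum full (suc k) (bs ++ b ∷ [])                     ≡⟨ cong (_+_ first) (weightedSum-∷ʳ full (suc k) bs b) ⟩
  first + (weightedSum full (suc k) bs + last (suc k ℕ.+ length bs))  ≡⟨ ℚ.+-assoc first (weightedSum full (suc k) bs) (last (suc k ℕ.+ length bs)) ⟨
  first + weightedSum full (suc k) bs + last (suc k ℕ.+ length bs)    ≡⟨ cong (λ i → first + weightedSum full (suc k) bs + last i) (sym (ℕ.+-suc k (length bs))) ⟩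
  first + weightedSum full (suc k) bs + last (k ℕ.+ length (b′ ∷ bs)) ∎
  where
  open ≡-Reasoning
  first : ℚ
  first = ℕtoℚ (suc (length full) C k) · b′
  last : ℕ → ℚ
  last i = ℕtoℚ (suc (length full) C i) · b

length-bernList : ∀ n → length (bernList n) ≡ n
length-bernList zero    = refl
length-bernList (suc n) = trans (List.length-++ (bernList n)) (trans (cong (ℕ._+ 1) (length-bernList n)) (ℕ.+-comm n 1))

weightedSum-bernList : ∀ full n → weightedSum full 0 (bernList (suc n)) ≡
  1ℚ + Σ₁ n (λ k → ℕtoℚ (suc (length full) C k) · bernoulli k)
weightedSum-bernList full zero    = cong (λ c → ℕtoℚ c · 1ℚ + 0ℚ) (nC0≡1 (suc (length full)))
weightedSum-bernList full (suc n) = trans (weightedSum-∷ʳ full 0 (bernList (suc n)) (bernoulli (suc n))) (trans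
  (cong₂ (λ s l → s + ℕtoℚ (suc (length full) C l) · bernoulli (suc n)) (weightedSum-bernList full n) (length-bernList (suc n)))
  (ℚ.+-assoc 1ℚ (Σ₁ n (λ k → ℕtoℚ (suc (length full) C k) · bernoulli k)) (ℕtoℚ (suc (length full) C suc n) · bernoulli (suc n))))

bernoulli-recurrence : ∀ n →
  1ℚ + Σ₁ n (λ k → ℕtoℚ (suc (suc n) C k) · bernoulli k) + ℕtoℚ (suc (suc n)) · bernoulli (suc n) ≡ 0ℚ
bernoulli-recurrence n = begin
  S + ℕtoℚ (suc (suc n)) · bernoulli (suc n)
    ≡⟨ cong (λ b → S + ℕtoℚ (suc (suc n)) · b) (nextB-weightedSum (bernList (suc n))) ⟩
  S + ℕtoℚ (suc (suc n)) · - (weightedSum (bernList (suc n)) 0 (bernList (suc n)) · recip (suc (length (bernList (suc n)))))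
    ≡⟨ cong₂ (λ w l → S + ℕtoℚ (suc (suc n)) · - (w · recip (suc l))) weighted (length-bernList (suc n)) ⟩
  S + ℕtoℚ (suc (suc n)) · - (S · recip (suc (suc n)))
    ≡⟨ factor S (ℕtoℚ (suc (suc n))) (recip (suc (suc n))) ⟩
  S · (1ℚ - recip (suc (suc n)) · ℕtoℚ (suc (suc n)))
    ≡⟨ cong (λ r → S · (1ℚ - r)) (recip-inverse (suc n)) ⟩
  S · (1ℚ - 1ℚ)
    ≡⟨ ℚ.*-zeroʳ S ⟩
  0ℚ ∎
  where
  open ≡-Reasoning
  S : ℚ
  S = 1ℚ + Σ₁ n (λ k → ℕtoℚ (suc (suc n) C k) · bernoulli k)
  weighted : weightedSum (bernList (suc n)) 0 (bernList (suc n)) ≡ S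
  weighted = trans (weightedSum-bernList (bernList (suc n)) n)
    (cong (λ l → 1ℚ + Σ₁ n (λ k → ℕtoℚ (suc l C k) · bernoulli k)) (length-bernList (suc n)))
  factor : ∀ s m r → s + m · - (s · r) ≡ s · (1ℚ - r · m)
  factor = solve-∀ ring

1↑ : ∀ n → 1ℚ ↑ n ≡ 1ℚ
1↑ zero    = refl
1↑ (suc n) = trans (ℚ.*-identityˡ (1ℚ ↑ n)) (1↑ n)

-- The two highest terms stand apart for two uses. In the Bernoulli recurrence they are the newly
-- determined number and the one left over; for n + 2 = p they are the terms with B₍p₋₁₎ and Bₚ.
umbral-top : ∀ x a n → umbral x a (suc (suc n)) ≡
  x ↑ suc (suc n) · a 0 + Σ₁ n (λ k → ℕtoℚ (suc (suc n) C k) · x ↑ (suc (suc n) ∸ k) · a k)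
  + ℕtoℚ (suc (suc n)) · x · a (suc n) + a (suc (suc n))
umbral-top x a n = begin
  umbral x a m
    ≡⟨ umbral-expand x a m ⟩
  h + (s + ℕtoℚ (m C suc n) · x ↑ (m ∸ suc n) · a (suc n) + ℕtoℚ (m C m) · x ↑ (m ∸ m) · a m)
    ≡⟨ cong₂ (λ c d → h + (s + ℕtoℚ c · x ↑ (m ∸ suc n) · a (suc n) + ℕtoℚ d · x ↑ (m ∸ m) · a m)) ([1+n]Cn≡1+n (suc n)) (nCn≡1 m) ⟩
  h + (s + ℕtoℚ m · x ↑ (m ∸ suc n) · a (suc n) + 1ℚ · x ↑ (m ∸ m) · a m)
    ≡⟨ cong₂ (λ i j → h + (s + ℕtoℚ m · x ↑ i · a (suc n) + 1ℚ · x ↑ j · a m)) (ℕ.m+n∸n≡m 1 (suc n)) (ℕ.n∸n≡0 m) ⟩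
  h + (s + ℕtoℚ m · (x · 1ℚ) · a (suc n) + 1ℚ · 1ℚ · a m)
    ≡⟨ tidy h s (ℕtoℚ m) x (a (suc n)) (a m) ⟩
  h + s + ℕtoℚ m · x · a (suc n) + a m ∎
  where
  open ≡-Reasoning
  m : ℕ
  m = suc (suc n)
  h s : ℚ
  h = x ↑ m · a 0
  s = Σ₁ n (λ k → ℕtoℚ (m C k) · x ↑ (m ∸ k) · a k)
  tidy : ∀ h s m x a b → h + (s + m · (x · 1ℚ) · a + 1ℚ · 1ℚ · b) ≡ h + s + m · x · a + b
  tidy = solve-∀ ring

umbral-top-1 : ∀ a n → umbral 1ℚ a (suc (suc n)) ≡
  a 0 + Σ₁ n (λ k → ℕtoℚ (suc (suc n) C k) · a k) + ℕtoℚ (suc (suc n)) · a (suc n) + a (suc (suc n))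
umbral-top-1 a n = trans (umbral-top 1ℚ a n) (cong₂ (λ s t → s + t + a (suc (suc n)))
  (cong₂ _+_ (trans (cong (_· a 0) (1↑ (suc (suc n)))) (ℚ.*-identityˡ (a 0)))
    (Σ₁-cong n λ k _ → cong (_· a (suc k)) (trans (cong (ℕtoℚ (suc (suc n) C suc k) ·_) (1↑ (suc (suc n) ∸ suc k))) (ℚ.*-identityʳ (ℕtoℚ (suc (suc n) C suc k))))))
  (cong (_· a (suc n)) (ℚ.*-identityʳ (ℕtoℚ (suc (suc n))))))

δ₁ : ℕ → ℚ
δ₁ zero          = 0ℚ
δ₁ (suc zero)    = 1ℚ
δ₁ (suc (suc n)) = 0ℚ

umbral-bernoulli : ∀ n → umbral 1ℚ bernoulli n ≡ bernoulli n + δ₁ n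
umbral-bernoulli zero          = refl
umbral-bernoulli (suc zero)    = refl
umbral-bernoulli (suc (suc n)) = trans (umbral-top-1 bernoulli n)
  (trans (cong (_+ bernoulli (suc (suc n))) (bernoulli-recurrence n)) (ℚ.+-comm 0ℚ (bernoulli (suc (suc n)))))

-- In the fixed-point equation at n + 2 the top term cancels. What remains is (n + 2) d (n + 1) plus
-- multiples of earlier terms, which vanish by induction.
umbral-fixed⇒0 : ∀ (d : ℕ → ℚ) → d 0 ≡ 0ℚ → (∀ n → umbral 1ℚ d n ≡ d n) → ∀ n k → k ≤ n → d k ≡ 0ℚ
umbral-fixed⇒0 d d0≡0 fixed zero    zero z≤n = d0≡0
umbral-fixed⇒0 d d0≡0 fixed (suc n) k    k≤1+n with ℕ.m≤n⇒m<n∨m≡n k≤1+n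
... | inj₁ (s≤s k≤n) = umbral-fixed⇒0 d d0≡0 fixed n k k≤n
... | inj₂ refl      = cancelʳ (suc n) (begin
  d (suc n) · ℕtoℚ m                              ≡⟨ isolate (d (suc n)) (ℕtoℚ m) (d m) ⟩
  0ℚ + 0ℚ + ℕtoℚ m · d (suc n) + d m - d m        ≡⟨ cong₂ (λ a s → a + s + ℕtoℚ m · d (suc n) + d m - d m) d0≡0 low ⟨
  d 0 + Σ₁ n (λ k → ℕtoℚ (m C k) · d k) + ℕtoℚ m · d (suc n) + d m - d m
                                                  ≡⟨ cong (_- d m) (umbral-top-1 d n) ⟨
  umbral 1ℚ d m - d m                             ≡⟨ cong (_- d m) (fixed m) ⟩
  d m - d m                                       ≡⟨ vanish (d m) (ℕtoℚ m) ⟩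
  0ℚ · ℕtoℚ m                                     ∎)
  where
  open ≡-Reasoning
  m : ℕ
  m = suc (suc n)
  low : Σ₁ n (λ k → ℕtoℚ (m C k) · d k) ≡ 0ℚ
  low = Σ₁-zero n λ k k<n → trans (cong (ℕtoℚ (m C suc k) ·_) (umbral-fixed⇒0 d d0≡0 fixed n (suc k) k<n)) (ℚ.*-zeroʳ (ℕtoℚ (m C suc k)))
  isolate : ∀ x m y → x · m ≡ 0ℚ + 0ℚ + m · x + y - y
  isolate = solve-∀ ring
  vanish : ∀ x m → x - x ≡ 0ℚ · m
  vanish = solve-∀ ring

-- (-1)ᵏ (Bₖ + δ₁ k) satisfies the recurrence of umbral-bernoulli too, hence equals Bₖ; d is the difference.
sgn-bernoulli : ∀ n → sgn n · bernoulli n ≡ bernoulli n + δ₁ n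
sgn-bernoulli n = begin
  sgn n · bernoulli n                                                 ≡⟨ reassemble (sgn n · bernoulli n) (δ₁ n) (bernoulli n) ⟩
  (sgn n · bernoulli n - δ₁ n) + - 1ℚ · bernoulli n + (bernoulli n + δ₁ n)
    ≡⟨ cong (λ y → y + - 1ℚ · bernoulli n + (bernoulli n + δ₁ n)) (sgn-umbral-bernoulli n) ⟨
  d n + (bernoulli n + δ₁ n)
    ≡⟨ cong (_+ (bernoulli n + δ₁ n)) (umbral-fixed⇒0 d refl fixed n n ℕ.≤-refl) ⟩
  0ℚ + (bernoulli n + δ₁ n)
    ≡⟨ ℚ.+-identityˡ (bernoulli n + δ₁ n) ⟩
  bernoulli n + δ₁ n ∎
  where
  open ≡-Reasoning
  d : ℕ → ℚ
  d k = sgn k · umbral 1ℚ bernoulli k + - 1ℚ · bernoulli k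

  sgn-δ₁ : ∀ k → sgn k · δ₁ k ≡ - δ₁ k
  sgn-δ₁ zero          = refl
  sgn-δ₁ (suc zero)    = refl
  sgn-δ₁ (suc (suc k)) = ℚ.*-zeroʳ (sgn (suc (suc k)))

  regroup : ∀ s b δ → s · (b + δ) ≡ s · b + s · δ
  regroup = solve-∀ ring
  sgn-umbral-bernoulli : ∀ k → sgn k · umbral 1ℚ bernoulli k ≡ sgn k · bernoulli k - δ₁ k
  sgn-umbral-bernoulli k = trans (cong (sgn k ·_) (umbral-bernoulli k))
    (trans (regroup (sgn k) (bernoulli k) (δ₁ k)) (cong (_+_ (sgn k · bernoulli k)) (sgn-δ₁ k)))

  inversion : ∀ k → umbral 1ℚ (λ j → sgn j · umbral 1ℚ bernoulli j) k ≡ sgn k · bernoulli k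
  inversion k = begin
    umbral 1ℚ (λ j → sgn j · umbral 1ℚ bernoulli j) k                ≡⟨ umbral-cong 1ℚ (sgn-umbral 1ℚ bernoulli) k ⟩
    umbral 1ℚ (umbral (- 1ℚ) (λ j → sgn j · bernoulli j)) k          ≡⟨ umbral-∘ 1ℚ (- 1ℚ) (λ j → sgn j · bernoulli j) k ⟩
    umbral 0ℚ (λ j → sgn j · bernoulli j) k                          ≡⟨ umbral-0 (λ j → sgn j · bernoulli j) k ⟩
    sgn k · bernoulli k                                              ∎

  swap : ∀ s b δ → s + - 1ℚ · (b + δ) ≡ (s - δ) + - 1ℚ · b
  swap = solve-∀ ring
  fixed : ∀ k → umbral 1ℚ d k ≡ d k
  fixed k = begin
    umbral 1ℚ d k
      ≡⟨ umbral-+ 1ℚ (λ j → sgn j · umbral 1ℚ bernoulli j) (λ j → - 1ℚ · bernoulli j) k ⟩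
    umbral 1ℚ (λ j → sgn j · umbral 1ℚ bernoulli j) k + umbral 1ℚ (λ j → - 1ℚ · bernoulli j) k
      ≡⟨ cong₂ _+_ (inversion k) (trans (umbral-* 1ℚ (- 1ℚ) bernoulli k) (cong (- 1ℚ ·_) (umbral-bernoulli k))) ⟩
    sgn k · bernoulli k + - 1ℚ · (bernoulli k + δ₁ k)
      ≡⟨ swap (sgn k · bernoulli k) (bernoulli k) (δ₁ k) ⟩
    (sgn k · bernoulli k - δ₁ k) + - 1ℚ · bernoulli k
      ≡⟨ cong (_+ - 1ℚ · bernoulli k) (sgn-umbral-bernoulli k) ⟨
    d k ∎

  reassemble : ∀ s δ b → s ≡ (s - δ) + - 1ℚ · b + (b + δ)
  reassemble = solve-∀ ring

-- `δ₁ k` is k 0ᵏ⁻¹, so `umbral-index` reduces the claim to the powers (x + 0)ⁿ.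
umbral-δ₁ : ∀ x n → umbral x δ₁ (suc n) ≡ ℕtoℚ (suc n) · x ↑ n
umbral-δ₁ x n = trans (umbral-cong x δ₁-index (suc n)) (trans (umbral-index x (λ k → 0ℚ ↑ (k ∸ 1)) n)
  (cong (ℕtoℚ (suc n) ·_) (umbral-0↑ n)))
  where
  δ₁-index : ∀ k → δ₁ k ≡ ℕtoℚ k · 0ℚ ↑ (k ∸ 1)
  δ₁-index zero          = refl
  δ₁-index (suc zero)    = refl
  δ₁-index (suc (suc k)) = sym (trans (cong (ℕtoℚ (suc (suc k)) ·_) (ℚ.*-zeroˡ (0ℚ ↑ k))) (ℚ.*-zeroʳ (ℕtoℚ (suc (suc k)))))

  umbral-const0 : ∀ n → umbral x (λ _ → 0ℚ) n ≡ 0ℚ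
  umbral-const0 n = trans (umbral-* x 0ℚ (λ _ → 0ℚ) n) (ℚ.*-zeroˡ (umbral x (λ _ → 0ℚ) n))

  umbral-0↑ : ∀ n → umbral x (λ k → 0ℚ ↑ k) n ≡ x ↑ n
  umbral-0↑ zero    = refl
  umbral-0↑ (suc n) = trans (cong₂ (λ y z → x · y + z) (umbral-0↑ n)
    (trans (umbral-cong x (λ k → ℚ.*-zeroˡ (0ℚ ↑ k)) n) (umbral-const0 n))) (ℚ.+-identityʳ (x · x ↑ n))

-- Faulhaber's formula by telescoping: moving the point from x to x + 1 replaces B by B + `δ₁`,
-- which adds exactly (n + 2) xⁿ⁺¹. The recursion starts at x = 1 with the empty sum.
powerSum : ∀ n N → umbral (ℕtoℚ (suc N)) bernoulli (suc (suc n)) ≡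
  bernoulli (suc (suc n)) + ℕtoℚ (suc (suc n)) · Σ₁ N (λ a → ℕtoℚ a ↑ suc n)
powerSum n zero = trans (umbral-bernoulli (suc (suc n)))
  (cong (_+_ (bernoulli (suc (suc n)))) (sym (ℚ.*-zeroʳ (ℕtoℚ (suc (suc n))))))
powerSum n (suc N) = begin
  umbral (ℕtoℚ (suc (suc N))) bernoulli m
    ≡⟨ cong (λ x → umbral x bernoulli m) (trans (ℕtoℚ-suc (suc N)) (ℚ.+-comm 1ℚ x)) ⟩
  umbral (x + 1ℚ) bernoulli m
    ≡⟨ umbral-∘ x 1ℚ bernoulli m ⟨
  umbral x (umbral 1ℚ bernoulli) m
    ≡⟨ umbral-cong x umbral-bernoulli m ⟩
  umbral x (λ k → bernoulli k + δ₁ k) m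
    ≡⟨ umbral-+ x bernoulli δ₁ m ⟩
  umbral x bernoulli m + umbral x δ₁ m
    ≡⟨ cong₂ _+_ (powerSum n N) (umbral-δ₁ x (suc n)) ⟩
  (bernoulli m + ℕtoℚ m · Σ₁ N (λ a → ℕtoℚ a ↑ suc n)) + ℕtoℚ m · x ↑ suc n
    ≡⟨ collect (bernoulli m) (ℕtoℚ m) (Σ₁ N (λ a → ℕtoℚ a ↑ suc n)) (x ↑ suc n) ⟩
  bernoulli m + ℕtoℚ m · Σ₁ (suc N) (λ a → ℕtoℚ a ↑ suc n) ∎
  where
  open ≡-Reasoning
  m : ℕ
  m = suc (suc n)
  x : ℚ
  x = ℕtoℚ (suc N)
  collect : ∀ b m s t → (b + m · s) + m · t ≡ b + m · (s + t)
  collect = solve-∀ ring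

-- Congruences between p-integral rationals

module Localization (p : ℕ) (p-prime : Prime p) where

  P : ℚ
  P = ℕtoℚ p

  -- Any denominator prime to p is accepted, not only the least one, so sums and products simply
  -- multiply denominators and Euclid's lemma does the rest.
  record Integral (x : ℚ) : Set where
    constructor integral
    field
      denom   : ℕ
      numer   : ℤ
      p∤denom : ¬ p ∣ denom
      clears  : x · ℕtoℚ denom ≡ fromℤ numer

  p∤1 : ¬ p ∣ 1
  p∤1 p∣1 = ¬prime[1] (subst Prime (∣1⇒≡1 p∣1) p-prime)

  p∤* : ∀ {m n} → ¬ p ∣ m → ¬ p ∣ n → ¬ p ∣ m * n
  p∤* {m} {n} p∤m p∤n p∣mn with euclidsLemma m n p-prime p∣mn
  ... | inj₁ p∣m = p∤m p∣m
  ... | inj₂ p∣n = p∤n p∣n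

  int-fromℤ : ∀ i → Integral (fromℤ i)
  int-fromℤ i = integral 1 i p∤1 (ℚ.*-identityʳ (fromℤ i))

  int-ℕ : ∀ n → Integral (ℕtoℚ n)
  int-ℕ n = int-fromℤ (+ n)

  int-neg : ∀ {x} → Integral x → Integral (- x)
  int-neg {x} (integral d a p∤d eq) = integral d (ℤ.- a) p∤d
    (trans (sym (ℚ.neg-distribˡ-* x (ℕtoℚ d))) (trans (cong -_ eq) (sym (fromℤ-neg a))))

  int-* : ∀ {x y} → Integral x → Integral y → Integral (x · y)
  int-* {x} {y} (integral d a p∤d eq) (integral e b p∤e eq′) = integral (d * e) (a ℤ.* b) (p∤* p∤d p∤e) (begin
    x · y · ℕtoℚ (d * e)             ≡⟨ cong (x · y ·_) (ℕtoℚ-* d e) ⟩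
    x · y · (ℕtoℚ d · ℕtoℚ e)        ≡⟨ interchange x y (ℕtoℚ d) (ℕtoℚ e) ⟩
    (x · ℕtoℚ d) · (y · ℕtoℚ e)      ≡⟨ cong₂ _·_ eq eq′ ⟩
    fromℤ a · fromℤ b                ≡⟨ fromℤ-* a b ⟨
    fromℤ (a ℤ.* b)                  ∎)
    where
    open ≡-Reasoning
    interchange : ∀ x y d e → x · y · (d · e) ≡ (x · d) · (y · e)
    interchange = solve-∀ ring

  int-+ : ∀ {x y} → Integral x → Integral y → Integral (x + y)
  int-+ {x} {y} (integral d a p∤d eq) (integral e b p∤e eq′) =
    integral (d * e) (a ℤ.* + e ℤ.+ b ℤ.* + d) (p∤* p∤d p∤e) (begin
    (x + y) · ℕtoℚ (d * e)                            ≡⟨ cong ((x + y) ·_) (ℕtoℚ-* d e) ⟩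
    (x + y) · (ℕtoℚ d · ℕtoℚ e)                       ≡⟨ cross x y (ℕtoℚ d) (ℕtoℚ e) ⟩
    (x · ℕtoℚ d) · ℕtoℚ e + (y · ℕtoℚ e) · ℕtoℚ d     ≡⟨ cong₂ (λ s t → s · ℕtoℚ e + t · ℕtoℚ d) eq eq′ ⟩
    fromℤ a · ℕtoℚ e + fromℤ b · ℕtoℚ d               ≡⟨ cong₂ _+_ (fromℤ-* a (+ e)) (fromℤ-* b (+ d)) ⟨
    fromℤ (a ℤ.* + e) + fromℤ (b ℤ.* + d)             ≡⟨ fromℤ-+ (a ℤ.* + e) (b ℤ.* + d) ⟨
    fromℤ (a ℤ.* + e ℤ.+ b ℤ.* + d)                   ∎)
    where
    open ≡-Reasoning
    cross : ∀ x y d e → (x + y) · (d · e) ≡ (x · d) · e + (y · e) · d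
    cross = solve-∀ ring

  int-recip : ∀ {n} → n < p ∸ 1 → Integral (recip (suc n))
  int-recip {n} n<p-1 = integral (suc n) (+ 1)
    (>⇒∤ (ℕ.<-≤-trans (s≤s n<p-1) (ℕ.≤-reflexive (ℕ.suc-pred p {{prime⇒nonZero p-prime}}))))
    (recip-inverse n)

  int-↑ : ∀ {x} n → Integral x → Integral (x ↑ n)
  int-↑ zero    _ = int-ℕ 1
  int-↑ (suc n) h = int-* h (int-↑ n h)

  int-sgn : ∀ n → Integral (sgn n)
  int-sgn n = int-↑ n (int-fromℤ (ℤ.- + 1))

  int-Σ₁ : ∀ n {f} → (∀ k → k < n → Integral (f (suc k))) → Integral (Σ₁ n f)
  int-Σ₁ zero    h = int-ℕ 0
  int-Σ₁ (suc n) h = int-+ (int-Σ₁ n λ k k<n → h k (ℕ.m<n⇒m<1+n k<n)) (h n ℕ.≤-refl)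

  infix 4 _≈_[mod_]
  -- Only the quotient has to be integral. This allows p B₍p₋₁₎ and (p B₍p₋₁₎ + 1) / p on either
  -- side, and treats the moduli p and p² alike.
  record _≈_[mod_] (x y m : ℚ) : Set where
    constructor congruent
    field
      quotient : ℚ
      isInt    : Integral quotient
      equation : x ≡ y + m · quotient

  module _ {m : ℚ} where

    ≈-reflexive : ∀ {x y} → x ≡ y → x ≈ y [mod m ]
    ≈-reflexive {x} {y} x≡y = congruent 0ℚ (int-ℕ 0) (trans x≡y (trivial y m))
      where
      trivial : ∀ y m → y ≡ y + m · 0ℚ
      trivial = solve-∀ ring

    ≈-sym : ∀ {x y} → x ≈ y [mod m ] → y ≈ x [mod m ]
    ≈-sym {x} {y} (congruent c h eq) = congruent (- c) (int-neg h) (trans (undo y m c) (cong (λ z → z + m · - c) (sym eq)))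
      where
      undo : ∀ y m c → y ≡ (y + m · c) + m · - c
      undo = solve-∀ ring

    ≈-trans : ∀ {x y z} → x ≈ y [mod m ] → y ≈ z [mod m ] → x ≈ z [mod m ]
    ≈-trans {x} {y} {z} (congruent c h eq) (congruent d k eq′) =
      congruent (d + c) (int-+ k h) (trans eq (trans (cong (_+ m · c) eq′) (merge z m d c)))
      where
      merge : ∀ z m d c → (z + m · d) + m · c ≡ z + m · (d + c)
      merge = solve-∀ ring

    ≈-+ : ∀ {x y u v} → x ≈ y [mod m ] → u ≈ v [mod m ] → x + u ≈ y + v [mod m ]
    ≈-+ {x} {y} {u} {v} (congruent c h eq) (congruent d k eq′) =
      congruent (c + d) (int-+ h k) (trans (cong₂ _+_ eq eq′) (merge y v m c d))
      where
      merge : ∀ y v m c d → (y + m · c) + (v + m · d) ≡ (y + v) + m · (c + d)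
      merge = solve-∀ ring

    ≈-+ˡ : ∀ x {u v} → u ≈ v [mod m ] → x + u ≈ x + v [mod m ]
    ≈-+ˡ x = ≈-+ (≈-reflexive {x} refl)

    ≈-+ʳ : ∀ u {x y} → x ≈ y [mod m ] → x + u ≈ y + u [mod m ]
    ≈-+ʳ u x≈y = ≈-+ x≈y (≈-reflexive {u} refl)

    ≈-* : ∀ {x y z} → Integral z → x ≈ y [mod m ] → z · x ≈ z · y [mod m ]
    ≈-* {x} {y} {z} hz (congruent c h eq) = congruent (z · c) (int-* hz h) (trans (cong (z ·_) eq) (spread z y m c))
      where
      spread : ∀ z y m c → z · (y + m · c) ≡ z · y + m · (z · c)
      spread = solve-∀ ring

    ≈-neg : ∀ {x y} → x ≈ y [mod m ] → - x ≈ - y [mod m ]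
    ≈-neg {x} {y} (congruent c h eq) = congruent (- c) (int-neg h) (trans (cong -_ eq) (negate y m c))
      where
      negate : ∀ y m c → - (y + m · c) ≡ - y + m · - c
      negate = solve-∀ ring

    ≈-Σ₁ : ∀ n {f g : ℕ → ℚ} → (∀ k → k < n → f (suc k) ≈ g (suc k) [mod m ]) → Σ₁ n f ≈ Σ₁ n g [mod m ]
    ≈-Σ₁ zero    h = ≈-reflexive refl
    ≈-Σ₁ (suc n) h = ≈-+ (≈-Σ₁ n λ k k<n → h k (ℕ.m<n⇒m<1+n k<n)) (h n ℕ.≤-refl)

    ≈0 : ∀ {x c} → Integral c → x ≡ m · c → x ≈ 0ℚ [mod m ]
    ≈0 {x} {c} h eq = congruent c h (trans eq (sym (ℚ.+-identityˡ (m · c))))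

    ≈-scale : ∀ {x y} z → x ≈ y [mod m ] → z · x ≈ z · y [mod z · m ]
    ≈-scale {x} {y} z (congruent c h eq) = congruent c h (trans (cong (z ·_) eq) (spread z y m c))
      where
      spread : ∀ z y m c → z · (y + m · c) ≡ z · y + z · m · c
      spread = solve-∀ ring

    ≈-isEquivalence : IsEquivalence (λ x y → x ≈ y [mod m ])
    ≈-isEquivalence = record { refl = ≈-reflexive refl ; sym = ≈-sym ; trans = ≈-trans }

    -- The passage from numerators modulo p² to Wilson and similar quotients modulo p.
    ≈-cancel : ∀ {x y} → P · x ≈ P · y [mod P · m ] → x ≈ y [mod m ]
    ≈-cancel {x} {y} (congruent c h eq) = congruent c h (cancel p {{prime⇒nonZero p-prime}}
      (trans (ℚ.*-comm x P) (trans eq (factor P y m c))))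
      where
      factor : ∀ P y m c → P · y + P · m · c ≡ (y + m · c) · P
      factor = solve-∀ ring
      cancel : ∀ q .{{_ : ℕ.NonZero q}} {u v} → u · ℕtoℚ q ≡ v · ℕtoℚ q → u ≡ v
      cancel (suc q) = cancelʳ q

  ≈-weaken : ∀ {x y} → x ≈ y [mod P · P ] → x ≈ y [mod P ]
  ≈-weaken {x} {y} (congruent c h eq) = congruent (P · c) (int-* (int-ℕ p) h) (trans eq (cong (_+_ y) (ℚ.*-assoc P P c)))

  ≈-setoid : ℚ → Setoid _ _
  ≈-setoid m = record { isEquivalence = ≈-isEquivalence {m} }

  -- With z = n / e in lowest terms and c = a / d, clearing denominators gives n d = p a e. As p
  -- does not divide d, it divides n, and coprimality keeps it out of e.
  multiple⇒modₚ : ∀ {z c} → Integral c → z ≡ P · c → (p ∣ ℤ.∣ ℚ.↥ z ∣) × ¬ (p ∣ ℚ.↧ₙ z)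
  multiple⇒modₚ {z} {c} (integral d a p∤d eq) z≡Pc = p∣n , lowest z p∣n
    where
    n : ℤ
    n = ℚ.↥ z
    e : ℕ
    e = ℚ.↧ₙ z
    swap : ∀ z d e → z · e · d ≡ z · d · e
    swap = solve-∀ ring
    cleared : n ℤ.* + d ≡ + p ℤ.* a ℤ.* + e
    cleared = fromℤ-injective (begin
      fromℤ (n ℤ.* + d)                ≡⟨ fromℤ-* n (+ d) ⟩
      fromℤ n · ℕtoℚ d                 ≡⟨ cong (_· ℕtoℚ d) (denominator-clears z) ⟨
      z · ℕtoℚ e · ℕtoℚ d              ≡⟨ swap z (ℕtoℚ d) (ℕtoℚ e) ⟩
      z · ℕtoℚ d · ℕtoℚ e              ≡⟨ cong (λ y → y · ℕtoℚ d · ℕtoℚ e) z≡Pc ⟩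
      P · c · ℕtoℚ d · ℕtoℚ e          ≡⟨ cong (_· ℕtoℚ e) (ℚ.*-assoc P c (ℕtoℚ d)) ⟩
      P · (c · ℕtoℚ d) · ℕtoℚ e        ≡⟨ cong (λ z → P · z · ℕtoℚ e) eq ⟩
      P · fromℤ a · ℕtoℚ e             ≡⟨ cong (_· ℕtoℚ e) (fromℤ-* (+ p) a) ⟨
      fromℤ (+ p ℤ.* a) · ℕtoℚ e       ≡⟨ fromℤ-* (+ p ℤ.* a) (+ e) ⟨
      fromℤ (+ p ℤ.* a ℤ.* + e)        ∎)
      where open ≡-Reasoning
    absolute : ℤ.∣ n ∣ * d ≡ ℤ.∣ a ∣ * e * p
    absolute = begin
      ℤ.∣ n ∣ * d                      ≡⟨ ℤ.abs-* n (+ d) ⟨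
      ℤ.∣ n ℤ.* + d ∣                  ≡⟨ cong ℤ.∣_∣ cleared ⟩
      ℤ.∣ + p ℤ.* a ℤ.* + e ∣          ≡⟨ ℤ.abs-* (+ p ℤ.* a) (+ e) ⟩
      ℤ.∣ + p ℤ.* a ∣ * e              ≡⟨ cong (_* e) (ℤ.abs-* (+ p) a) ⟩
      p * ℤ.∣ a ∣ * e                  ≡⟨ ℕ.*-assoc p ℤ.∣ a ∣ e ⟩
      p * (ℤ.∣ a ∣ * e)                ≡⟨ ℕ.*-comm p (ℤ.∣ a ∣ * e) ⟩
      ℤ.∣ a ∣ * e * p                  ∎
      where open ≡-Reasoning
    p∣n : p ∣ ℤ.∣ n ∣
    p∣n = [ id , (λ p∣d → contradiction p∣d p∤d) ]′ (euclidsLemma ℤ.∣ n ∣ d p-prime (divides (ℤ.∣ a ∣ * e) absolute))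
    lowest : ∀ z → p ∣ ℤ.∣ ℚ.↥ z ∣ → ¬ p ∣ ℚ.↧ₙ z
    lowest (ℚ.mkℚ _ _ coprime) p∣↥ p∣↧ = ⊥-elim-irr (¬prime[1] (subst Prime (coprime (p∣↥ , p∣↧)) p-prime))

  ≈⇒modₚ : ∀ {x y} → x ≈ y [mod P ] → x ≡ y [modₚ p ]
  ≈⇒modₚ {x} {y} (congruent c int-c eq) = multiple⇒modₚ int-c (trans (cong (_- y) eq) (difference y P c))
    where
    difference : ∀ y P c → (y + P · c) - y ≡ P · c
    difference = solve-∀ ring

-- Powers of 2, binomial coefficients, harmonic and alternating sums

recip-* : ∀ m n → recip (m * n) ≡ recip m · recip n
recip-* zero    n       = sym (ℚ.*-zeroˡ (recip n))
recip-* (suc m) zero    = trans (cong recip (ℕ.*-zeroʳ m)) (sym (ℚ.*-zeroʳ (recip (suc m))))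
recip-* (suc m) (suc n) = cancelʳ (n ℕ.+ m * suc n) (begin
  recip (suc m * suc n) · ℕtoℚ (suc m * suc n)
    ≡⟨ recip-inverse (n ℕ.+ m * suc n) ⟩
  1ℚ
    ≡⟨ cong₂ _·_ (recip-inverse m) (recip-inverse n) ⟨
  (recip (suc m) · ℕtoℚ (suc m)) · (recip (suc n) · ℕtoℚ (suc n))
    ≡⟨ interchange (recip (suc m)) (ℕtoℚ (suc m)) (recip (suc n)) (ℕtoℚ (suc n)) ⟩
  recip (suc m) · recip (suc n) · (ℕtoℚ (suc m) · ℕtoℚ (suc n))
    ≡⟨ cong (recip (suc m) · recip (suc n) ·_) (ℕtoℚ-* (suc m) (suc n)) ⟨
  recip (suc m) · recip (suc n) · ℕtoℚ (suc m * suc n) ∎)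
  where
  open ≡-Reasoning
  interchange : ∀ a b c d → (a · b) · (c · d) ≡ a · c · (b · d)
  interchange = solve-∀ ring

½ : ℚ
½ = recip 2

recip-2^ : ∀ k → recip (2 ^ k) ≡ ½ ↑ k
recip-2^ zero    = refl
recip-2^ (suc k) = trans (recip-* 2 (2 ^ k)) (cong (½ ·_) (recip-2^ k))

2↑-∸ : ∀ n k → k ≤ n → ℕtoℚ 2 ↑ (n ∸ k) ≡ ℕtoℚ 2 ↑ n · ½ ↑ k
2↑-∸ n       zero    z≤n       = sym (ℚ.*-identityʳ (ℕtoℚ 2 ↑ n))
2↑-∸ (suc n) (suc k) (s≤s k≤n) = begin
  ℕtoℚ 2 ↑ (n ∸ k)                            ≡⟨ 2↑-∸ n k k≤n ⟩
  ℕtoℚ 2 ↑ n · ½ ↑ k                          ≡⟨ ℚ.*-identityˡ (ℕtoℚ 2 ↑ n · ½ ↑ k) ⟨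
  ℕtoℚ 2 · ½ · (ℕtoℚ 2 ↑ n · ½ ↑ k)           ≡⟨ interchange (ℕtoℚ 2) ½ (ℕtoℚ 2 ↑ n) (½ ↑ k) ⟩
  ℕtoℚ 2 ↑ suc n · ½ ↑ suc k                  ∎
  where
  open ≡-Reasoning
  interchange : ∀ a b c d → a · b · (c · d) ≡ a · c · (b · d)
  interchange = solve-∀ ring

C-absorb : ∀ n k → ℕtoℚ (suc k) · ℕtoℚ (suc n C suc k) ≡ ℕtoℚ (suc n) · ℕtoℚ (n C k)
C-absorb n zero = begin
  1ℚ · ℕtoℚ (suc n C 1)        ≡⟨ cong (λ c → 1ℚ · ℕtoℚ c) (nC1≡n (suc n)) ⟩
  1ℚ · ℕtoℚ (suc n)            ≡⟨ ℚ.*-comm 1ℚ (ℕtoℚ (suc n)) ⟩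
  ℕtoℚ (suc n) · 1ℚ            ≡⟨ cong (λ c → ℕtoℚ (suc n) · ℕtoℚ c) (nC0≡1 n) ⟨
  ℕtoℚ (suc n) · ℕtoℚ (n C 0)  ∎
  where open ≡-Reasoning
C-absorb zero (suc k) = begin
  ℕtoℚ (suc (suc k)) · ℕtoℚ (1 C suc (suc k))  ≡⟨ cong (λ c → ℕtoℚ (suc (suc k)) · ℕtoℚ c) (k>n⇒nCk≡0 {1} {suc (suc k)} (s≤s (s≤s z≤n))) ⟩
  ℕtoℚ (suc (suc k)) · 0ℚ                      ≡⟨ ℚ.*-zeroʳ (ℕtoℚ (suc (suc k))) ⟩
  1ℚ · 0ℚ                                      ≡⟨ cong (λ c → 1ℚ · ℕtoℚ c) (k>n⇒nCk≡0 {0} {suc k} (s≤s z≤n)) ⟨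
  1ℚ · ℕtoℚ (0 C suc k)                        ∎
  where open ≡-Reasoning
C-absorb (suc n) (suc k) = begin
  ℕtoℚ (suc (suc k)) · ℕtoℚ (suc (suc n) C suc (suc k))
    ≡⟨ cong (ℕtoℚ (suc (suc k)) ·_) (pascal (suc n) (suc k)) ⟩
  ℕtoℚ (suc (suc k)) · (c + d)
    ≡⟨ ℚ.*-distribˡ-+ (ℕtoℚ (suc (suc k))) c d ⟩
  ℕtoℚ (suc (suc k)) · c + ℕtoℚ (suc (suc k)) · d
    ≡⟨ cong₂ (λ m y → m · c + y) (ℕtoℚ-suc (suc k)) (C-absorb n (suc k)) ⟩
  (1ℚ + ℕtoℚ (suc k)) · c + ℕtoℚ (suc n) · ℕtoℚ (n C suc k)
    ≡⟨ split (ℕtoℚ (suc k)) c (ℕtoℚ (suc n) · ℕtoℚ (n C suc k)) ⟩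
  ℕtoℚ (suc k) · c + c + ℕtoℚ (suc n) · ℕtoℚ (n C suc k)
    ≡⟨ cong (λ y → y + c + ℕtoℚ (suc n) · ℕtoℚ (n C suc k)) (C-absorb n k) ⟩
  ℕtoℚ (suc n) · ℕtoℚ (n C k) + c + ℕtoℚ (suc n) · ℕtoℚ (n C suc k)
    ≡⟨ join (ℕtoℚ (suc n)) (ℕtoℚ (n C k)) c (ℕtoℚ (n C suc k)) ⟩
  ℕtoℚ (suc n) · (ℕtoℚ (n C k) + ℕtoℚ (n C suc k)) + c
    ≡⟨ cong (λ y → ℕtoℚ (suc n) · y + c) (pascal n k) ⟨
  ℕtoℚ (suc n) · c + c
    ≡⟨ one-more (ℕtoℚ (suc n)) c ⟩
  (1ℚ + ℕtoℚ (suc n)) · c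
    ≡⟨ cong (_· c) (ℕtoℚ-suc (suc n)) ⟨
  ℕtoℚ (suc (suc n)) · c ∎
  where
  open ≡-Reasoning
  c d : ℚ
  c = ℕtoℚ (suc n C suc k)
  d = ℕtoℚ (suc n C suc (suc k))
  split : ∀ m c y → (1ℚ + m) · c + y ≡ m · c + c + y
  split = solve-∀ ring
  join : ∀ m a c b → m · a + c + m · b ≡ m · (a + b) + c
  join = solve-∀ ring
  one-more : ∀ m c → m · c + c ≡ (1ℚ + m) · c
  one-more = solve-∀ ring

signedC : ℕ → ℕ → ℚ
signedC n k = sgn k · ℕtoℚ (n C k)

-- The ratio of consecutive signed coefficients is -(n - k) / (k + 1) = 1 - (n + 1) / (k + 1). For n
-- + 1 = p each step thus multiplies by 1 - p / (k + 1).
signedC-suc : ∀ n k → signedC n (suc k) ≡ signedC n k - ℕtoℚ (suc n) · (recip (suc k) · signedC n k)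
signedC-suc n k = cancelʳ k (begin
  - 1ℚ · s · d · K
    ≡⟨ add-sub s c d K ⟩
  s · c · K - s · (K · (c + d))
    ≡⟨ cong (λ y → s · c · K - s · (K · y)) (pascal n k) ⟨
  s · c · K - s · (K · ℕtoℚ (suc n C suc k))
    ≡⟨ cong (λ y → s · c · K - s · y) (C-absorb n k) ⟩
  s · c · K - s · (N · c)
    ≡⟨ insert s c K N ⟩
  s · c · K - N · (1ℚ · (s · c))
    ≡⟨ cong (λ y → s · c · K - N · (y · (s · c))) (recip-inverse k) ⟨
  s · c · K - N · (recip (suc k) · K · (s · c))
    ≡⟨ factor s c K N (recip (suc k)) ⟩
  (s · c - N · (recip (suc k) · (s · c))) · K ∎)
  where
  open ≡-Reasoning
  s c d K N : ℚ
  s = sgn k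
  c = ℕtoℚ (n C k)
  d = ℕtoℚ (n C suc k)
  K = ℕtoℚ (suc k)
  N = ℕtoℚ (suc n)
  add-sub : ∀ s c d K → - 1ℚ · s · d · K ≡ s · c · K - s · (K · (c + d))
  add-sub = solve-∀ ring
  insert : ∀ s c K N → s · c · K - s · (N · c) ≡ s · c · K - N · (1ℚ · (s · c))
  insert = solve-∀ ring
  factor : ∀ s c K N r → s · c · K - N · (r · K · (s · c)) ≡ (s · c - N · (r · (s · c))) · K
  factor = solve-∀ ring

-- The reciprocal 1 / j occurs in n + 1 - j of the harmonic numbers, and (n + 1 - j) / j = (n + 1) /
-- j - 1.
Σ₁-harmonic : ∀ n → Σ₁ n harmonic ≡ ℕtoℚ (suc n) · harmonic n - ℕtoℚ n
Σ₁-harmonic zero    = refl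
Σ₁-harmonic (suc n) = begin
  Σ₁ n harmonic + (H + r)                           ≡⟨ cong (_+ (H + r)) (Σ₁-harmonic n) ⟩
  N · H - ℕtoℚ n + (H + r)                          ≡⟨ collect N H (ℕtoℚ n) r ⟩
  (1ℚ + N) · (H + r) - (ℕtoℚ n + r · N)             ≡⟨ cong (λ y → (1ℚ + N) · (H + r) - (ℕtoℚ n + y)) (recip-inverse n) ⟩
  (1ℚ + N) · (H + r) - (ℕtoℚ n + 1ℚ)                ≡⟨ cong (λ y → (1ℚ + N) · (H + r) - y) (ℚ.+-comm (ℕtoℚ n) 1ℚ) ⟩
  (1ℚ + N) · (H + r) - (1ℚ + ℕtoℚ n)                ≡⟨ cong₂ (λ y z → y · (H + r) - z) (ℕtoℚ-suc (suc n)) (ℕtoℚ-suc n) ⟨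
  ℕtoℚ (suc (suc n)) · (H + r) - N                  ∎
  where
  open ≡-Reasoning
  H r N : ℚ
  H = harmonic n
  r = recip (suc n)
  N = ℕtoℚ (suc n)
  collect : ∀ N H n r → N · H - n + (H + r) ≡ (1ℚ + N) · (H + r) - (n + r · N)
  collect = solve-∀ ring

alternating : ℕ → ℚ
alternating n = Σ₁ n (λ k → sgn k · recip k)

sgn-*2 : ∀ n → sgn (n * 2) ≡ 1ℚ
sgn-*2 zero    = refl
sgn-*2 (suc n) = cong (λ s → - 1ℚ · (- 1ℚ · s)) (sgn-*2 n)

-- Adding the harmonic sum to the alternating one cancels the odd terms and doubles the even ones,
-- and 2 / (2 j) = 1 / j.
alternating-*2 : ∀ n → alternating (n * 2) ≡ harmonic n - harmonic (n * 2)
alternating-*2 zero    = refl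
alternating-*2 (suc n) = begin
  alternating m + - 1ℚ · sgn m · recip (suc m) + - 1ℚ · (- 1ℚ · sgn m) · recip (suc (suc m))
    ≡⟨ cong₂ (λ A s → A + - 1ℚ · s · recip (suc m) + - 1ℚ · (- 1ℚ · s) · recip (suc (suc m))) (alternating-*2 n) (sgn-*2 n) ⟩
  harmonic n - harmonic m + - 1ℚ · 1ℚ · recip (suc m) + - 1ℚ · (- 1ℚ · 1ℚ) · recip (suc (suc m))
    ≡⟨ collect (harmonic n) (harmonic m) (recip (suc m)) (recip (suc (suc m))) ⟩
  harmonic n + (1ℚ + 1ℚ) · recip (suc (suc m)) - harmonic (suc (suc m))
    ≡⟨ cong (λ y → harmonic n + y - harmonic (suc (suc m))) doubled ⟩
  harmonic (suc n) - harmonic (suc (suc m)) ∎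
  where
  open ≡-Reasoning
  m : ℕ
  m = n * 2
  collect : ∀ h H r t → h - H + - 1ℚ · 1ℚ · r + - 1ℚ · (- 1ℚ · 1ℚ) · t ≡ h + (1ℚ + 1ℚ) · t - (H + r + t)
  collect = solve-∀ ring
  swap : ∀ t r h → t · (r · h) ≡ r · (t · h)
  swap = solve-∀ ring
  doubled : (1ℚ + 1ℚ) · recip (suc n * 2) ≡ recip (suc n)
  doubled = trans (cong ((1ℚ + 1ℚ) ·_) (recip-* (suc n) 2))
    (trans (swap (1ℚ + 1ℚ) (recip (suc n)) ½) (ℚ.*-identityʳ (recip (suc n))))

Σ₁-δ₁ : ∀ n (f : ℕ → ℚ) → Σ₁ (suc n) (λ k → δ₁ k · f k) ≡ f 1
Σ₁-δ₁ n f = trans (Σ₁-head n (λ k → δ₁ k · f k)) (trans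
  (cong₂ _+_ (ℚ.*-identityˡ (f 1)) (Σ₁-zero n λ k _ → ℚ.*-zeroˡ (f (suc (suc k)))))
  (ℚ.+-identityʳ (f 1)))

sgn-isEven : ∀ k → sgn k ≡ (if isEven k then 1ℚ else - 1ℚ)
sgn-isEven zero    = refl
sgn-isEven (suc k) with isEven k | sgn-isEven k
... | true  | eq = cong (- 1ℚ ·_) eq
... | false | eq = cong (- 1ℚ ·_) eq

double-even : ∀ k x → (1ℚ + 1ℚ) · (if isEven k then x else 0ℚ) ≡ x + sgn k · x
double-even k x with isEven k | sgn-isEven k
... | true  | eq = trans (twice x) (cong (λ s → x + s · x) (sym eq))
  where
  twice : ∀ x → (1ℚ + 1ℚ) · x ≡ x + 1ℚ · x
  twice = solve-∀ ring
... | false | eq = trans (nothing x) (cong (λ s → x + s · x) (sym eq))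
  where
  nothing : ∀ x → (1ℚ + 1ℚ) · 0ℚ ≡ x + - 1ℚ · x
  nothing = solve-∀ ring

-- The congruences for a prime p = 2 g + 3

module OddPrime (g : ℕ) (p-prime : Prime (3 ℕ.+ g * 2)) where

  -- In terms of p these are p - 3, p - 2, p - 1 and p itself. In this form the truncated
  -- subtractions from p compute, and (p - 1) / 2 is `suc g`.
  n r q p : ℕ
  n = g * 2
  r = suc n
  q = suc r
  p = suc q

  open Localization p p-prime

  r<q : r < q
  r<q = ℕ.n<1+n r

  sgn-q : sgn q ≡ 1ℚ
  sgn-q = sgn-*2 (suc g)

  -- Binomial coefficients modulo p and p², Fermat's theorem

  int-harmonic : ∀ k → k ≤ q → Integral (harmonic k)
  int-harmonic k k≤q = int-Σ₁ k λ j j<k → int-recip (ℕ.<-≤-trans j<k k≤q)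

  signedC≈ : ∀ k → k ≤ q → signedC q k ≈ 1ℚ - P · harmonic k [mod P · P ]
  signedC≈ zero    _     = ≈-reflexive (start P)
    where
    start : ∀ P → 1ℚ ≡ 1ℚ - P · 0ℚ
    start = solve-∀ ring
  -- The quotient is what stands at P² in the product (1 - P H + P² c) (1 - P t).
  signedC≈ (suc k) k<q = congruent (c + t · H - P · (t · c))
    (int-+ (int-+ IH.isInt (int-* int-t (int-harmonic k (ℕ.<⇒≤ k<q)))) (int-neg (int-* (int-ℕ p) (int-* int-t IH.isInt))))
    (trans (signedC-suc q k) (trans (cong (λ e → e - P · (t · e)) IH.equation) (expand P H c t)))
    where
    module IH = _≈_[mod_] (signedC≈ k (ℕ.<⇒≤ k<q))
    c t H : ℚ
    c = IH.quotient
    t = recip (suc k)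
    H = harmonic k
    int-t : Integral t
    int-t = int-recip k<q
    expand : ∀ P H c t → (1ℚ - P · H) + P · P · c - P · (t · ((1ℚ - P · H) + P · P · c))
      ≡ 1ℚ - P · (H + t) + P · P · (c + t · H - P · (t · c))
    expand = solve-∀ ring

  signedC≈1 : ∀ k → k ≤ q → signedC q k ≈ 1ℚ [mod P ]
  signedC≈1 k k≤q = ≈-trans (≈-weaken (signedC≈ k k≤q))
    (congruent (- harmonic k) (int-neg (int-harmonic k k≤q)) (cong (_+_ 1ℚ) (ℚ.neg-distribʳ-* P (harmonic k))))

  -- This is C p (k + 1) / p, in a form that makes it visibly integral for k + 1 < p.
  quotC : ℕ → ℚ
  quotC k = recip (suc k) · ℕtoℚ (q C k)

  pC≡P·quotC : ∀ k → ℕtoℚ (p C suc k) ≡ P · quotC k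
  pC≡P·quotC k = cancelʳ k (begin
    ℕtoℚ (p C suc k) · ℕtoℚ (suc k)            ≡⟨ ℚ.*-comm (ℕtoℚ (p C suc k)) (ℕtoℚ (suc k)) ⟩
    ℕtoℚ (suc k) · ℕtoℚ (p C suc k)            ≡⟨ C-absorb q k ⟩
    P · c                                      ≡⟨ ℚ.*-identityˡ (P · c) ⟨
    1ℚ · (P · c)                               ≡⟨ cong (_· (P · c)) (recip-inverse k) ⟨
    recip (suc k) · ℕtoℚ (suc k) · (P · c)     ≡⟨ swap (recip (suc k)) (ℕtoℚ (suc k)) P c ⟩
    P · quotC k · ℕtoℚ (suc k)                 ∎)
    where
    open ≡-Reasoning
    c : ℚ
    c = ℕtoℚ (q C k)
    swap : ∀ t K P c → t · K · (P · c) ≡ P · (t · c) · K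
    swap = solve-∀ ring

  int-quotC : ∀ k → k < q → Integral (quotC k)
  int-quotC k k<q = int-* (int-recip k<q) (int-ℕ (q C k))

  quotC≈ : ∀ k → k < q → quotC k ≈ - (sgn (suc k) · recip (suc k)) [mod P ]
  quotC≈ k k<q = ≈-trans (≈-reflexive unsign)
    (≈-trans (≈-* (int-* (int-recip k<q) (int-sgn k)) (signedC≈1 k (ℕ.<⇒≤ k<q))) (≈-reflexive (resign (sgn k) (recip (suc k)))))
    where
    square : ∀ s t c → s · s · (t · c) ≡ t · s · (s · c)
    square = solve-∀ ring
    unsign : quotC k ≡ recip (suc k) · sgn k · signedC q k
    unsign = trans (sym (trans (cong (_· quotC k) (sgn² k)) (ℚ.*-identityˡ (quotC k)))) (square (sgn k) (recip (suc k)) (ℕtoℚ (q C k)))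
    resign : ∀ s t → t · s · 1ℚ ≡ - (- 1ℚ · s · t)
    resign = solve-∀ ring

  -- Kept as an equation because the Bernoulli numbers will be substituted for `a`: the term `a q`
  -- is then not integral, and only the middle sum may be reduced after a cancellation of p.
  umbral-prime : ∀ x a →
    umbral x a p ≡ x ↑ p · a 0 + P · Σ₁ r (λ k → quotC (k ∸ 1) · x ↑ (p ∸ k) · a k) + P · x · a q + a p
  umbral-prime x a = trans (umbral-top x a r) (cong (λ s → x ↑ p · a 0 + s + P · x · a q + a p)
    (trans (Σ₁-cong r λ k _ → trans (cong (λ c → c · x ↑ (p ∸ suc k) · a (suc k)) (pC≡P·quotC k))
      (assoc P (quotC k) (x ↑ (p ∸ suc k)) (a (suc k))))
      (Σ₁-* r P (λ k → quotC (k ∸ 1) · x ↑ (p ∸ k) · a k))))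
    where
    assoc : ∀ P c y b → P · c · y · b ≡ P · (c · y · b)
    assoc = solve-∀ ring

  -- The last signed coefficient is exactly 1, so 1 ≡ 1 - p H modulo p², from which one factor p is
  -- cancelled.
  harmonic-q≈0 : harmonic q ≈ 0ℚ [mod P ]
  harmonic-q≈0 = ≈-cancel (congruent c E.isInt (begin
    P · harmonic q                                          ≡⟨ isolate P (harmonic q) c ⟩
    P · 0ℚ + P · P · c + (1ℚ - (1ℚ - P · harmonic q + P · P · c))
      ≡⟨ cong (λ y → P · 0ℚ + P · P · c + (1ℚ - y)) (trans (sym E.equation) top) ⟩
    P · 0ℚ + P · P · c + (1ℚ - 1ℚ)                          ≡⟨ ℚ.+-identityʳ (P · 0ℚ + P · P · c) ⟩
    P · 0ℚ + P · P · c                                      ∎))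
    where
    module E = _≈_[mod_] (signedC≈ q ℕ.≤-refl)
    c : ℚ
    c = E.quotient
    open ≡-Reasoning
    isolate : ∀ P H c → P · H ≡ P · 0ℚ + P · P · c + (1ℚ - (1ℚ - P · H + P · P · c))
    isolate = solve-∀ ring
    top : signedC q q ≡ 1ℚ
    top = cong₂ (λ s c → s · ℕtoℚ c) sgn-q (nCn≡1 q)

  -- Induction on `a`: for the constant sequence 1, `umbral-prime` expands (a + 1)ᵖ, and all terms
  -- but the two outer ones carry a factor p.
  fermat : ∀ a → ℕtoℚ a ↑ p ≈ ℕtoℚ a [mod P ]
  fermat zero    = ≈-reflexive (ℚ.*-zeroˡ (ℕtoℚ 0 ↑ q))
  fermat (suc a) = begin
    ℕtoℚ (suc a) ↑ p
      ≡⟨ cong (_↑ p) (trans (ℕtoℚ-suc a) (ℚ.+-comm 1ℚ x)) ⟩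
    (x + 1ℚ) ↑ p
      ≡⟨ umbral-1 x p ⟨
    umbral x (λ _ → 1ℚ) p
      ≡⟨ umbral-prime x (λ _ → 1ℚ) ⟩
    x ↑ p · 1ℚ + P · S + P · x · 1ℚ + 1ℚ
      ≡⟨ collect (x ↑ p) P S x ⟩
    x ↑ p + 1ℚ + P · (S + x)
      ≈⟨ ≈-+ (≈-+ʳ 1ℚ (fermat a)) (≈0 int-S+x refl) ⟩
    x + 1ℚ + 0ℚ
      ≡⟨ ℚ.+-identityʳ (x + 1ℚ) ⟩
    x + 1ℚ
      ≡⟨ trans (ℚ.+-comm x 1ℚ) (sym (ℕtoℚ-suc a)) ⟩
    ℕtoℚ (suc a) ∎
    where
    open SetoidReasoning (≈-setoid P)
    x S : ℚ
    x = ℕtoℚ a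
    S = Σ₁ r (λ k → quotC (k ∸ 1) · x ↑ (p ∸ k) · 1ℚ)
    int-S+x : Integral (S + x)
    int-S+x = int-+ (int-Σ₁ r λ k k<r → int-* (int-* (int-quotC k (ℕ.<-trans k<r r<q)) (int-↑ (p ∸ suc k) (int-ℕ a))) (int-ℕ 1)) (int-ℕ a)
    collect : ∀ y P S x → y · 1ℚ + P · S + P · x · 1ℚ + 1ℚ ≡ y + 1ℚ + P · (S + x)
    collect = solve-∀ ring

  fermat-unit : ∀ k → k < q → ℕtoℚ (suc k) ↑ q ≈ 1ℚ [mod P ]
  fermat-unit k k<q = begin
    x ↑ q               ≡⟨ ℚ.*-identityˡ (x ↑ q) ⟨
    1ℚ · x ↑ q          ≡⟨ cong (_· x ↑ q) (recip-inverse k) ⟨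
    t · x · x ↑ q       ≡⟨ ℚ.*-assoc t x (x ↑ q) ⟩
    t · x ↑ p           ≈⟨ ≈-* (int-recip k<q) (fermat (suc k)) ⟩
    t · x               ≡⟨ recip-inverse k ⟩
    1ℚ                  ∎
    where
    open SetoidReasoning (≈-setoid P)
    x t : ℚ
    x = ℕtoℚ (suc k)
    t = recip (suc k)

  -- Since 1 / (p - 1) + 1 = p / (p - 1), the quotient is `recip q` once more.
  recip-q≈ : recip q ≈ - 1ℚ [mod P ]
  recip-q≈ = congruent (recip q) (int-recip r<q) (begin
    recip q                                             ≡⟨ complete (recip q) (ℕtoℚ q) ⟩
    - 1ℚ + (1ℚ + ℕtoℚ q) · recip q + (1ℚ - recip q · ℕtoℚ q)
      ≡⟨ cong₂ (λ y z → - 1ℚ + y · recip q + (1ℚ - z)) (sym (ℕtoℚ-suc q)) (recip-inverse r) ⟩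
    - 1ℚ + P · recip q + (1ℚ - 1ℚ)                      ≡⟨ ℚ.+-identityʳ (- 1ℚ + P · recip q) ⟩
    - 1ℚ + P · recip q                                  ∎)
    where
    open ≡-Reasoning
    complete : ∀ t K → t ≡ - 1ℚ + (1ℚ + K) · t + (1ℚ - t · K)
    complete = solve-∀ ring

  P·-÷p : ∀ x → P · (x ÷ₙ p) ≡ x
  P·-÷p x = trans (rotate P x (recip p)) (trans (cong (x ·_) (recip-inverse q)) (ℚ.*-identityʳ x))
    where
    rotate : ∀ P x t → P · (x · t) ≡ x · (t · P)
    rotate = solve-∀ ring

  P-cancel : ∀ {x y} → P · x ≡ P · y → x ≡ y
  P-cancel {x} {y} eq = cancelʳ q (trans (ℚ.*-comm x P) (trans eq (ℚ.*-comm P y)))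

  -- The Fermat quotient of 2 and harmonic numbers

  Q W β b : ℚ
  Q = fermatQ2 p
  W = wilsonQ p
  β = bernQ p
  b = bernoulli q

  2ℚ : ℚ
  2ℚ = ℕtoℚ 2

  2↑q : 2ℚ ↑ q ≡ 1ℚ + P · Q
  2↑q = trans (sym (ℕtoℚ-^ 2 q)) (trans (shift (ℕtoℚ (2 ^ q))) (cong (_+_ 1ℚ) (sym (P·-÷p (ℕtoℚ (2 ^ q) - 1ℚ)))))
    where
    shift : ∀ x → x ≡ 1ℚ + (x - 1ℚ)
    shift = solve-∀ ring

  -- Compares 2ᵖ = 2 + 2 p Q with the expansion of (1 + 1)ᵖ. The final 1 is the term k = p - 1,
  -- where C p k / p is exactly 1, so the alternating sum stops at p - 2.
  2Q≈ : 2ℚ · Q ≈ - alternating r + 1ℚ [mod P ]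
  2Q≈ = begin
    2ℚ · Q
      ≡⟨ P-cancel exact ⟩
    Σ₁ r (λ k → quotC (k ∸ 1) · 1ℚ ↑ (p ∸ k) · 1ℚ) + 1ℚ
      ≡⟨ cong (_+ 1ℚ) (Σ₁-cong r λ k _ → trans (ℚ.*-identityʳ (quotC k · 1ℚ ↑ (p ∸ suc k)))
           (trans (cong (quotC k ·_) (1↑ (p ∸ suc k))) (ℚ.*-identityʳ (quotC k)))) ⟩
    Σ₁ r (λ k → quotC (k ∸ 1)) + 1ℚ
      ≈⟨ ≈-+ʳ 1ℚ (≈-Σ₁ r λ k k<r → quotC≈ k (ℕ.<-trans k<r r<q)) ⟩
    Σ₁ r (λ k → - (sgn k · recip k)) + 1ℚ
      ≡⟨ cong (_+ 1ℚ) (Σ₁-neg r (λ k → sgn k · recip k)) ⟩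
    - alternating r + 1ℚ ∎
    where
    open SetoidReasoning (≈-setoid P)
    S : ℚ
    S = Σ₁ r (λ k → quotC (k ∸ 1) · 1ℚ ↑ (p ∸ k) · 1ℚ)
    solve-for : ∀ P Q S one → one ≡ 1ℚ → (1ℚ + 1ℚ) · (1ℚ + P · Q) ≡ one · 1ℚ + P · S + P · 1ℚ · 1ℚ + 1ℚ →
      P · ((1ℚ + 1ℚ) · Q) ≡ P · (S + 1ℚ)
    solve-for P Q S .1ℚ refl eq = trans (before P Q) (trans (cong (_- (1ℚ + 1ℚ)) eq) (after P S))
      where
      before : ∀ P Q → P · ((1ℚ + 1ℚ) · Q) ≡ (1ℚ + 1ℚ) · (1ℚ + P · Q) - (1ℚ + 1ℚ)
      before = solve-∀ ring
      after : ∀ P S → 1ℚ · 1ℚ + P · S + P · 1ℚ · 1ℚ + 1ℚ - (1ℚ + 1ℚ) ≡ P · (S + 1ℚ)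
      after = solve-∀ ring
    exact : P · (2ℚ · Q) ≡ P · (S + 1ℚ)
    exact = solve-for P Q S (1ℚ ↑ p) (1↑ p) (trans (cong (2ℚ ·_) (sym 2↑q))
      (trans (sym (umbral-1 1ℚ p)) (umbral-prime 1ℚ (λ _ → 1ℚ))))

  alternating-q≈ : alternating r ≈ alternating q + 1ℚ [mod P ]
  alternating-q≈ = begin
    alternating r                             ≡⟨ undo (alternating r) (recip q) ⟩
    alternating r + 1ℚ · recip q + - recip q  ≡⟨ cong (λ s → alternating r + s · recip q + - recip q) sgn-q ⟨
    alternating q + - recip q                 ≈⟨ ≈-+ˡ (alternating q) (≈-neg recip-q≈) ⟩
    alternating q + 1ℚ                        ∎
    where
    open SetoidReasoning (≈-setoid P)
    undo : ∀ A t → A ≡ A + 1ℚ · t + - t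
    undo = solve-∀ ring

  -- Extending the alternating sum to the even bound p - 1 absorbs the constant 1. The extended sum
  -- splits into two harmonic numbers, of which the one at p - 1 vanishes modulo p.
  2Q≈-harmonic : 2ℚ · Q ≈ - harmonic (suc g) [mod P ]
  2Q≈-harmonic = begin
    2ℚ · Q                                 ≈⟨ 2Q≈ ⟩
    - alternating r + 1ℚ                       ≈⟨ ≈-+ʳ 1ℚ (≈-neg alternating-q≈) ⟩
    - (alternating q + 1ℚ) + 1ℚ                ≡⟨ cong (λ A → - (A + 1ℚ) + 1ℚ) (alternating-*2 (suc g)) ⟩
    - (harmonic (suc g) - harmonic q + 1ℚ) + 1ℚ ≡⟨ tidy (harmonic (suc g)) (harmonic q) ⟩
    - harmonic (suc g) + harmonic q            ≈⟨ ≈-+ˡ (- harmonic (suc g)) harmonic-q≈0 ⟩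
    - harmonic (suc g) + 0ℚ                    ≡⟨ ℚ.+-identityʳ (- harmonic (suc g)) ⟩
    - harmonic (suc g)                         ∎
    where
    open SetoidReasoning (≈-setoid P)
    tidy : ∀ h H → - (h - H + 1ℚ) + 1ℚ ≡ - h + H
    tidy = solve-∀ ring

  -- Bernoulli numbers up to index p

  int-½ : Integral ½
  int-½ = int-recip (s≤s (s≤s z≤n))

  -- As p is odd and greater than 1, the reflection `sgn-bernoulli` reads -Bₚ = Bₚ.
  bernoulli-p : bernoulli p ≡ 0ℚ
  bernoulli-p = begin
    B                             ≡⟨ halve B ⟩
    ½ · (B + 0ℚ - - 1ℚ · B)       ≡⟨ cong (λ s → ½ · (B + 0ℚ - - 1ℚ · s · B)) (trans (ℚ.*-identityʳ 1ℚ) (sym sgn-q)) ⟩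
    ½ · (B + 0ℚ - sgn p · B)      ≡⟨ cong (λ y → ½ · (y - sgn p · B)) (sgn-bernoulli p) ⟨
    ½ · (sgn p · B - sgn p · B)   ≡⟨ cong (½ ·_) (ℚ.+-inverseʳ (sgn p · B)) ⟩
    0ℚ                            ∎
    where
    open ≡-Reasoning
    B : ℚ
    B = bernoulli p
    double : ∀ B h → h · (B + 0ℚ - - 1ℚ · 1ℚ · B) ≡ h · (1ℚ + 1ℚ) · B
    double = solve-∀ ring
    halve : ∀ B → B ≡ ½ · (B + 0ℚ - - 1ℚ · 1ℚ · B)
    halve B = sym (trans (double B ½) (ℚ.*-identityˡ B))

  -- The recurrence for Bⱼ divides by j + 1, which is prime to p as long as j ≤ p - 2; at j = p - 1
  -- it would divide by p.
  int-bernoulli : ∀ N k → k ≤ N → N ≤ r → Integral (bernoulli k)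
  int-bernoulli zero    zero z≤n   _   = int-ℕ 1
  int-bernoulli (suc N) k    k≤1+N N<r with ℕ.m≤n⇒m<n∨m≡n k≤1+N
  ... | inj₁ (s≤s k≤N) = int-bernoulli N k k≤N (ℕ.<⇒≤ N<r)
  ... | inj₂ refl      = subst Integral (sym solved)
    (int-* (int-neg (int-recip {suc N} (s≤s N<r)))
      (int-+ (int-ℕ 1) (int-Σ₁ N λ j j<N → int-* (int-ℕ (suc (suc N) C suc j)) (int-bernoulli N (suc j) j<N (ℕ.<⇒≤ N<r)))))
    where
    open ≡-Reasoning
    S t K B : ℚ
    S = 1ℚ + Σ₁ N (λ k → ℕtoℚ (suc (suc N) C k) · bernoulli k)
    t = recip (suc (suc N))
    K = ℕtoℚ (suc (suc N))
    B = bernoulli (suc N)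
    rearrange : ∀ t K S B → (t · K) · B ≡ t · (S + K · B) + - t · S
    rearrange = solve-∀ ring
    solved : B ≡ - t · S
    solved = begin
      B                          ≡⟨ ℚ.*-identityˡ B ⟨
      1ℚ · B                     ≡⟨ cong (_· B) (recip-inverse (suc N)) ⟨
      t · K · B                  ≡⟨ rearrange t K S B ⟩
      t · (S + K · B) + - t · S  ≡⟨ cong (λ y → t · y + - t · S) (bernoulli-recurrence N) ⟩
      t · 0ℚ + - t · S           ≡⟨ cong (_+ - t · S) (ℚ.*-zeroʳ t) ⟩
      0ℚ + - t · S               ≡⟨ ℚ.+-identityˡ (- t · S) ⟩
      - t · S                    ∎

  int-B : ∀ k → k < r → Integral (bernoulli (suc k))
  int-B k k<r = int-bernoulli r (suc k) k<r ℕ.≤-refl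

  Pβ : P · β ≡ P · b + 1ℚ
  Pβ = P·-÷p (P · b + 1ℚ)

  -- The sums of Bₖ / k and Bₖ / (k 2ᵏ)

  S T : ℚ
  S = Σ₁ r modB
  T = Σ₁ r (λ k → modB k ÷ₙ (2 ^ k))

  -- Replacing C p k / p by (-1)ᵏ⁻¹ / k and then (-1)ᵏ Bₖ by Bₖ + δ₁ k.
  quotC-bernoulli≈ : (f : ℕ → ℚ) → (∀ k → k < r → Integral (f (suc k))) →
    Σ₁ r (λ k → quotC (k ∸ 1) · bernoulli k · f k) ≈ - (Σ₁ r (λ k → modB k · f k) + f 1) [mod P ]
  quotC-bernoulli≈ f int-f = begin
    Σ₁ r (λ k → quotC (k ∸ 1) · bernoulli k · f k)
      ≡⟨ Σ₁-cong r (λ k _ → commute (quotC k) (bernoulli (suc k)) (f (suc k))) ⟩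
    Σ₁ r (λ k → bernoulli k · f k · quotC (k ∸ 1))
      ≈⟨ ≈-Σ₁ r (λ k k<r → ≈-* (int-* (int-B k k<r) (int-f k k<r)) (quotC≈ k (ℕ.<-trans k<r r<q))) ⟩
    Σ₁ r (λ k → bernoulli k · f k · - (sgn k · recip k))
      ≡⟨ Σ₁-cong r (λ k _ → trans (gather (bernoulli (suc k)) (f (suc k)) (sgn (suc k)) (recip (suc k)))
           (trans (cong (λ y → - (y · recip (suc k) · f (suc k))) (sgn-bernoulli (suc k)))
             (cong -_ (spread (bernoulli (suc k)) (δ₁ (suc k)) (recip (suc k)) (f (suc k)))))) ⟩
    Σ₁ r (λ k → - (modB k · f k + δ₁ k · (recip k · f k)))
      ≡⟨ Σ₁-neg r (λ k → modB k · f k + δ₁ k · (recip k · f k)) ⟩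
    - Σ₁ r (λ k → modB k · f k + δ₁ k · (recip k · f k))
      ≡⟨ cong -_ (Σ₁-+ r (λ k → modB k · f k) (λ k → δ₁ k · (recip k · f k))) ⟩
    - (Σ₁ r (λ k → modB k · f k) + Σ₁ r (λ k → δ₁ k · (recip k · f k)))
      ≡⟨ cong (λ y → - (Σ₁ r (λ k → modB k · f k) + y)) (trans (Σ₁-δ₁ n (λ k → recip k · f k)) (ℚ.*-identityˡ (f 1))) ⟩
    - (Σ₁ r (λ k → modB k · f k) + f 1) ∎
    where
    open SetoidReasoning (≈-setoid P)
    commute : ∀ c B f → c · B · f ≡ B · f · c
    commute = solve-∀ ring
    gather : ∀ B f s t → B · f · - (s · t) ≡ - (s · B · t · f)
    gather = solve-∀ ring
    spread : ∀ B δ t f → (B + δ) · t · f ≡ B · t · f + δ · (t · f)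
    spread = solve-∀ ring

  -- At x = 1 both sides contain Bₚ = 0, which leaves 0 = 1 + p `S₁` + p B₍p₋₁₎ and so β = -`S₁`
  -- exactly. The 1 on the right is the correction for B₁.
  β≈S+1 : β ≈ S + 1ℚ [mod P ]
  β≈S+1 = begin
    β                         ≡⟨ P-cancel exact ⟩
    - S₁                      ≡⟨ cong -_ (Σ₁-cong r λ k _ → trans (cong (λ y → quotC k · y · bernoulli (suc k)) (1↑ (p ∸ suc k))) (commute (quotC k) (bernoulli (suc k)))) ⟩
    - Σ₁ r (λ k → quotC (k ∸ 1) · bernoulli k · 1ℚ)
                              ≈⟨ ≈-neg (quotC-bernoulli≈ (λ _ → 1ℚ) (λ _ _ → int-ℕ 1)) ⟩
    - - (Σ₁ r (λ k → modB k · 1ℚ) + 1ℚ)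
                              ≡⟨ involutive (Σ₁ r (λ k → modB k · 1ℚ) + 1ℚ) ⟩
    Σ₁ r (λ k → modB k · 1ℚ) + 1ℚ
                              ≡⟨ cong (_+ 1ℚ) (Σ₁-cong r λ k _ → ℚ.*-identityʳ (modB (suc k))) ⟩
    S + 1ℚ                    ∎
    where
    open SetoidReasoning (≈-setoid P)
    S₁ : ℚ
    S₁ = Σ₁ r (λ k → quotC (k ∸ 1) · 1ℚ ↑ (p ∸ k) · bernoulli k)
    involutive : ∀ x → - - x ≡ x
    involutive = solve-∀ ring
    commute : ∀ c B → c · 1ℚ · B ≡ c · B · 1ℚ
    commute = solve-∀ ring
    solve-for : ∀ P b S one → one ≡ 1ℚ → 0ℚ ≡ one · 1ℚ + P · S + P · 1ℚ · b + 0ℚ → P · b + 1ℚ ≡ P · - S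
    solve-for P b S .1ℚ refl eq = trans (before P b S) (trans (cong (_+ P · - S) (sym eq)) (ℚ.+-identityˡ (P · - S)))
      where
      before : ∀ P b S → P · b + 1ℚ ≡ 1ℚ · 1ℚ + P · S + P · 1ℚ · b + 0ℚ + P · - S
      before = solve-∀ ring
    exact : P · β ≡ P · - S₁
    exact = trans Pβ (solve-for P b S₁ (1ℚ ↑ p) (1↑ p) (trans
      (sym (trans (umbral-bernoulli p) (trans (ℚ.+-identityʳ (bernoulli p)) bernoulli-p)))
      (trans (umbral-prime 1ℚ bernoulli) (cong (_+_ (1ℚ ↑ p · 1ℚ + P · S₁ + P · 1ℚ · b)) bernoulli-p))))

  T≡ : T ≡ Σ₁ r (λ k → modB k · ½ ↑ k)
  T≡ = Σ₁-cong r λ k _ → cong (modB (suc k) ·_) (recip-2^ (suc k))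

  -- At x = 2 the expansion reads p = 2 (1 + p Q) + p `S₂` + 2 p B₍p₋₁₎. Since p B₍p₋₁₎ = p β - 1,
  -- the constants cancel and 1 = 2 Q + `S₂` + 2 β, where `S₂` ≡ -2 T - 1.
  T≈ : T ≈ Q + (β - 1ℚ) [mod P ]
  T≈ = begin
    -- An identity for every `S₂`. Its first bracket equals 1 by `exact`, so that only `S₂ + 2ℚ · T`
    -- remains to be reduced modulo p.
    T                                            ≡⟨ expand T Q β S₂ ⟩
    Q + β - ½ · (2ℚ · Q + S₂ + 2ℚ · β) + ½ · (S₂ + 2ℚ · T)
      ≡⟨ cong (λ y → Q + β - ½ · y + ½ · (S₂ + 2ℚ · T)) (P-cancel exact) ⟨
    Q + β - ½ · 1ℚ + ½ · (S₂ + 2ℚ · T)       ≈⟨ ≈-+ˡ (Q + β - ½ · 1ℚ) (≈-* int-½ (≈-+ʳ (2ℚ · T) S₂≈)) ⟩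
    Q + β - ½ · 1ℚ + ½ · (2ℚ · - (T + ½ · 1ℚ) + 2ℚ · T)
                                                 ≡⟨ finish T Q β ⟩
    Q + (β - 1ℚ)                                 ∎
    where
    open SetoidReasoning (≈-setoid P)
    S₂ S₂′ : ℚ
    S₂  = Σ₁ r (λ k → quotC (k ∸ 1) · 2ℚ ↑ (p ∸ k) · bernoulli k)
    S₂′ = Σ₁ r (λ k → quotC (k ∸ 1) · bernoulli k · ½ ↑ k)

    expand′ : ∀ h T Q β S → h · (1ℚ + 1ℚ) ≡ 1ℚ →
      T ≡ Q + β - h · ((1ℚ + 1ℚ) · Q + S + (1ℚ + 1ℚ) · β) + h · (S + (1ℚ + 1ℚ) · T)
    expand′ h T Q β S eq = sym (trans (collect h T Q β S) (trans (cong (λ y → Q + β + y · (T - Q - β)) eq) (cancel T Q β)))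
      where
      collect : ∀ h T Q β S → Q + β - h · ((1ℚ + 1ℚ) · Q + S + (1ℚ + 1ℚ) · β) + h · (S + (1ℚ + 1ℚ) · T)
        ≡ Q + β + h · (1ℚ + 1ℚ) · (T - Q - β)
      collect = solve-∀ ring
      cancel : ∀ T Q β → Q + β + 1ℚ · (T - Q - β) ≡ T
      cancel = solve-∀ ring
    expand : ∀ T Q β S → T ≡ Q + β - ½ · (2ℚ · Q + S + 2ℚ · β) + ½ · (S + 2ℚ · T)
    expand T Q β S = expand′ ½ T Q β S refl

    finish : ∀ T Q β → Q + β - ½ · 1ℚ + ½ · (2ℚ · - (T + ½ · 1ℚ) + 2ℚ · T) ≡ Q + (β - 1ℚ)
    finish T Q β = trans (collect ½ T Q β) (cong (λ y → Q + (β - y)) {½ + ½ · (1ℚ + 1ℚ) · ½} {1ℚ} refl)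
      where
      collect : ∀ h T Q β → Q + β - h · 1ℚ + h · ((1ℚ + 1ℚ) · - (T + h · 1ℚ) + (1ℚ + 1ℚ) · T)
        ≡ Q + (β - (h + h · (1ℚ + 1ℚ) · h))
      collect = solve-∀ ring

    -- With 2ᵖ pulled out the weights become 2⁻ᵏ, as in `T`; Fermat's theorem then replaces 2ᵖ by 2.
    doubled : S₂ ≡ 2ℚ ↑ p · S₂′
    doubled = trans (Σ₁-cong r λ k k<r → trans
        (cong (λ y → quotC k · y · bernoulli (suc k)) (2↑-∸ p (suc k) (s≤s (ℕ.<⇒≤ (ℕ.<-trans k<r r<q)))))
        (move (quotC k) (2ℚ ↑ p) (½ ↑ suc k) (bernoulli (suc k))))
      (Σ₁-* r (2ℚ ↑ p) (λ k → quotC (k ∸ 1) · bernoulli k · ½ ↑ k))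
      where
      move : ∀ c x h B → c · (x · h) · B ≡ x · (c · B · h)
      move = solve-∀ ring

    S₂≈ : S₂ ≈ 2ℚ · - (T + ½ · 1ℚ) [mod P ]
    S₂≈ = begin
      S₂                                ≡⟨ doubled ⟩
      2ℚ ↑ p · S₂′                  ≡⟨ ℚ.*-comm (2ℚ ↑ p) S₂′ ⟩
      S₂′ · 2ℚ ↑ p                  ≈⟨ ≈-* int-S₂′ (fermat 2) ⟩
      S₂′ · 2ℚ                      ≡⟨ ℚ.*-comm S₂′ 2ℚ ⟩
      2ℚ · S₂′                      ≈⟨ ≈-* (int-ℕ 2) (quotC-bernoulli≈ (½ ↑_) (λ k _ → int-↑ (suc k) int-½)) ⟩
      2ℚ · - (Σ₁ r (λ k → modB k · ½ ↑ k) + ½ · 1ℚ)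
                                        ≡⟨ cong (λ y → 2ℚ · - (y + ½ · 1ℚ)) T≡ ⟨
      2ℚ · - (T + ½ · 1ℚ)           ∎
      where
      int-S₂′ : Integral S₂′
      int-S₂′ = int-Σ₁ r λ k k<r → int-* (int-* (int-quotC k (ℕ.<-trans k<r r<q)) (int-B k k<r)) (int-↑ (suc k) int-½)

    solve-for : ∀ P Q S b β → P · β ≡ P · b + 1ℚ →
      P ≡ (1ℚ + 1ℚ) · (1ℚ + P · Q) · 1ℚ + P · S + P · (1ℚ + 1ℚ) · b + 0ℚ →
      P · 1ℚ ≡ P · ((1ℚ + 1ℚ) · Q + S + (1ℚ + 1ℚ) · β)
    solve-for P Q S b β eqβ eq = trans (ℚ.*-identityʳ P) (trans eq (trans (before P Q S b)
      (trans (cong (λ y → P · ((1ℚ + 1ℚ) · Q + S) + (1ℚ + 1ℚ) · y) (sym eqβ)) (after P Q S β))))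
      where
      before : ∀ P Q S b → (1ℚ + 1ℚ) · (1ℚ + P · Q) · 1ℚ + P · S + P · (1ℚ + 1ℚ) · b + 0ℚ
        ≡ P · ((1ℚ + 1ℚ) · Q + S) + (1ℚ + 1ℚ) · (P · b + 1ℚ)
      before = solve-∀ ring
      after : ∀ P Q S β → P · ((1ℚ + 1ℚ) · Q + S) + (1ℚ + 1ℚ) · (P · β) ≡ P · ((1ℚ + 1ℚ) · Q + S + (1ℚ + 1ℚ) · β)
      after = solve-∀ ring

    -- At x = 2 the power sum consists of the single term 1ᵖ⁻¹.
    at-2 : umbral 2ℚ bernoulli p ≡ P
    at-2 = trans (powerSum r 1) (trans
      (cong₂ (λ y z → y + P · (0ℚ + z)) bernoulli-p (1↑ q)) (unit P))
      where
      unit : ∀ P → 0ℚ + P · (0ℚ + 1ℚ) ≡ P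
      unit = solve-∀ ring

    exact : P · 1ℚ ≡ P · (2ℚ · Q + S₂ + 2ℚ · β)
    exact = solve-for P Q S₂ b β Pβ (trans (sym at-2) (trans (umbral-prime 2ℚ bernoulli)
      (cong₂ (λ y z → 2ℚ · y · 1ℚ + P · S₂ + P · 2ℚ · b + z) 2↑q bernoulli-p)))

  -- The power sum modulo p² and the Wilson quotient

  G : ℚ
  G = Σ₁ q (λ a → ℕtoℚ a ↑ q)

  -- After division by p, the terms with k ≤ p - 2 still carry pᵖ⁻ᵏ, hence p², and the leading term
  -- is pᵖ⁻¹ with p ≥ 3. Only the term k = p - 1 survives.
  G≈ : G ≈ P · b [mod P · P ]
  G≈ = begin
    G                                            ≡⟨ P-cancel exact ⟩
    P · b + (P · (P · P ↑ n) + S₃)               ≈⟨ ≈-+ˡ (P · b) (≈-+ (≈0 (int-↑ n (int-ℕ p)) (sym (ℚ.*-assoc P P (P ↑ n)))) S₃≈0) ⟩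
    P · b + (0ℚ + 0ℚ)                            ≡⟨ ℚ.+-identityʳ (P · b) ⟩
    P · b                                        ∎
    where
    open SetoidReasoning (≈-setoid (P · P))
    S₃ : ℚ
    S₃ = Σ₁ r (λ k → quotC (k ∸ 1) · P ↑ (p ∸ k) · bernoulli k)
    pull : ∀ c P y B → c · (P · (P · y)) · B ≡ P · P · (c · y · B)
    pull = solve-∀ ring
    Σ₁-0 : ∀ N → Σ₁ N (λ _ → 0ℚ) ≡ 0ℚ
    Σ₁-0 N = Σ₁-zero N λ _ _ → refl
    S₃≈0 : S₃ ≈ 0ℚ [mod P · P ]
    S₃≈0 = ≈-trans (≈-Σ₁ r λ k k<r → ≈0
        (int-* (int-* (int-quotC k (ℕ.<-trans k<r r<q)) (int-↑ (n ∸ k) (int-ℕ p))) (int-B k k<r))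
        (trans (cong (λ e → quotC k · P ↑ e · bernoulli (suc k)) (ℕ.+-∸-assoc 2 (ℕ.s≤s⁻¹ k<r)))
          (pull (quotC k) P (P ↑ (n ∸ k)) (bernoulli (suc k)))))
      (≈-reflexive (Σ₁-0 r))
    rearrange : ∀ P y S b → P · y · 1ℚ + P · S + P · P · b + 0ℚ ≡ P · (P · b + (y + S))
    rearrange = solve-∀ ring
    exact : P · G ≡ P · (P · b + (P · (P · P ↑ n) + S₃))
    exact = trans (sym (trans (powerSum r q) (trans (cong (_+ P · G) bernoulli-p) (ℚ.+-identityˡ (P · G)))))
      (trans (umbral-prime P bernoulli) (trans (cong (_+_ (P ↑ p · 1ℚ + P · S₃ + P · P · b)) bernoulli-p)
        (rearrange P (P ↑ q) S₃ b)))

  -- The correction to the power sum is -p (H₁ + ... + H₍p₋₁₎). The inner sum equals p H₍p₋₁₎ - (p -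
  -- 1), which is 1 modulo p, hence the summand -p.
  factorial≈ : ℕtoℚ (q ℕ.!) ≈ P · b - P [mod P · P ]
  factorial≈ = begin
    ℕtoℚ (q ℕ.!)
      ≡⟨ differences-top q ⟨
    umbral (- 1ℚ) (λ k → ℕtoℚ k ↑ q) q
      ≡⟨ umbral-expand (- 1ℚ) (λ k → ℕtoℚ k ↑ q) q ⟩
    sgn q · (0ℚ · 0ℚ ↑ r) + Σ₁ q (λ k → ℕtoℚ (q C k) · sgn (q ∸ k) · ℕtoℚ k ↑ q)
      ≡⟨ cong₂ _+_ (trans (cong (sgn q ·_) (ℚ.*-zeroˡ (0ℚ ↑ r))) (ℚ.*-zeroʳ (sgn q)))
           (Σ₁-cong q λ k k<q → trans (cong (λ s → ℕtoℚ (q C suc k) · s · ℕtoℚ (suc k) ↑ q) (sgn-flip (suc k) k<q))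
             (commute (ℕtoℚ (q C suc k)) (sgn (suc k)) (ℕtoℚ (suc k) ↑ q))) ⟩
    0ℚ + Σ₁ q (λ k → ℕtoℚ k ↑ q · signedC q k)
      ≡⟨ ℚ.+-identityˡ (Σ₁ q (λ k → ℕtoℚ k ↑ q · signedC q k)) ⟩
    Σ₁ q (λ k → ℕtoℚ k ↑ q · signedC q k)
      ≈⟨ ≈-Σ₁ q term≈ ⟩
    Σ₁ q (λ k → ℕtoℚ k ↑ q + - P · harmonic k)
      ≡⟨ trans (Σ₁-+ q (λ k → ℕtoℚ k ↑ q) (λ k → - P · harmonic k)) (cong (_+_ G) (Σ₁-* q (- P) harmonic)) ⟩
    G + - P · Σ₁ q harmonic
      ≡⟨ cong (λ y → G + - P · y) (Σ₁-harmonic q) ⟩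
    G + - P · (P · harmonic q - ℕtoℚ q)
      ≡⟨ cong (_+_ G) (trans (rearrange P (harmonic q) (ℕtoℚ q)) (cong (λ y → P · (y - 1ℚ) + P · P · - harmonic q) (sym (ℕtoℚ-suc q)))) ⟩
    G + (P · (P - 1ℚ) + P · P · - harmonic q)
      ≡⟨ cong (_+_ G) (regroup P (harmonic q)) ⟩
    G + (- P + P · P · (1ℚ - harmonic q))
      ≈⟨ ≈-+ G≈ (congruent (1ℚ - harmonic q) (int-+ (int-ℕ 1) (int-neg (int-harmonic q ℕ.≤-refl))) refl) ⟩
    P · b - P ∎
    where
    open SetoidReasoning (≈-setoid (P · P))
    commute : ∀ c s y → c · s · y ≡ y · (s · c)
    commute = solve-∀ ring
    rearrange : ∀ P H K → - P · (P · H - K) ≡ P · (1ℚ + K - 1ℚ) + P · P · - H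
    rearrange = solve-∀ ring
    regroup : ∀ P H → P · (P - 1ℚ) + P · P · - H ≡ - P + P · P · (1ℚ - H)
    regroup = solve-∀ ring
    sgn-flip : ∀ k → k ≤ q → sgn (q ∸ k) ≡ sgn k
    sgn-flip k k≤q = trans (sgn-∸ q k k≤q) (trans (cong (_· sgn k) sgn-q) (ℚ.*-identityˡ (sgn k)))
    expand : ∀ y P H → y · (1ℚ - P · H) ≡ y + - (P · (H · y))
    expand = solve-∀ ring
    collapse : ∀ P H → P · (H · 1ℚ) ≡ P · H
    collapse = solve-∀ ring
    term≈ : ∀ k → k < q → ℕtoℚ (suc k) ↑ q · signedC q (suc k) ≈ ℕtoℚ (suc k) ↑ q + - P · harmonic (suc k) [mod P · P ]
    term≈ k k<q = begin
      y · signedC q (suc k)   ≈⟨ ≈-* (int-↑ q (int-ℕ (suc k))) (signedC≈ (suc k) k<q) ⟩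
      y · (1ℚ - P · H)        ≡⟨ expand y P H ⟩
      -- The summand already has a factor p, so Fermat's theorem modulo p gives a congruence modulo
      -- p².
      y + - (P · (H · y))     ≈⟨ ≈-+ˡ y (≈-neg (≈-scale P (≈-* (int-harmonic (suc k) k<q) (fermat-unit k k<q)))) ⟩
      y + - (P · (H · 1ℚ))    ≡⟨ cong (_+_ y) (trans (cong -_ (collapse P H)) (ℚ.neg-distribˡ-* P H)) ⟩
      y + - P · H             ∎
      where
      y H : ℚ
      y = ℕtoℚ (suc k) ↑ q
      H = harmonic (suc k)

  W≈ : W ≈ β - 1ℚ [mod P ]
  W≈ = ≈-cancel (begin
    P · W                     ≡⟨ P·-÷p (ℕtoℚ (q ℕ.! ℕ.+ 1)) ⟩
    ℕtoℚ (q ℕ.! ℕ.+ 1)        ≡⟨ ℕtoℚ-+ (q ℕ.!) 1 ⟩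
    ℕtoℚ (q ℕ.!) + 1ℚ         ≈⟨ ≈-+ʳ 1ℚ factorial≈ ⟩
    P · b - P + 1ℚ            ≡⟨ swap (P · b) P ⟩
    P · b + 1ℚ - P            ≡⟨ cong (_- P) Pβ ⟨
    P · β - P                 ≡⟨ factor P β ⟩
    P · (β - 1ℚ)              ∎)
    where
    open SetoidReasoning (≈-setoid (P · P))
    swap : ∀ y P → y - P + 1ℚ ≡ y + 1ℚ - P
    swap = solve-∀ ring
    factor : ∀ P β → P · β - P ≡ P · (β - 1ℚ)
    factor = solve-∀ ring

  S≈ : S ≈ β - 1ℚ [mod P ]
  S≈ = ≈-trans (≈-reflexive (shift S)) (≈-+ʳ (- 1ℚ) (≈-sym β≈S+1))
    where
    shift : ∀ S → S ≡ S + 1ℚ - 1ℚ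
    shift = solve-∀ ring

  T≈Q+W : T ≈ Q + W [mod P ]
  T≈Q+W = ≈-trans T≈ (≈-+ˡ Q (≈-sym W≈))

  T≈harmonic : T ≈ - (harmonic (suc g) ÷ₙ 2) + β - 1ℚ [mod P ]
  T≈harmonic = begin
    T                                         ≈⟨ T≈ ⟩
    Q + (β - 1ℚ)                              ≡⟨ trans (cong (_+ (β - 1ℚ)) (halve Q)) (sym (ℚ.+-assoc (½ · (2ℚ · Q)) β (- 1ℚ))) ⟩
    ½ · (2ℚ · Q) + β - 1ℚ                 ≈⟨ ≈-+ʳ (- 1ℚ) (≈-+ʳ β (≈-* int-½ 2Q≈-harmonic)) ⟩
    ½ · - harmonic (suc g) + β - 1ℚ           ≡⟨ cong (λ y → y + β - 1ℚ) (move ½ (harmonic (suc g))) ⟩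
    - (harmonic (suc g) ÷ₙ 2) + β - 1ℚ        ∎
    where
    open SetoidReasoning (≈-setoid P)
    halve : ∀ Q → Q ≡ ½ · (2ℚ · Q)
    halve Q = sym (trans (sym (ℚ.*-assoc ½ 2ℚ Q)) (ℚ.*-identityˡ Q))
    move : ∀ h H → h · - H ≡ - (H · h)
    move = solve-∀ ring

  -- The sums over even k

  X Y : ℚ
  X = Σ₁ r (λ k → if isEven k then bernoulli k ÷ₙ (k * 2 ^ k) else ℕtoℚ 0)
  Y = Σ₁ r (λ k → if isEven k then (bernoulli k - 1ℚ) ÷ₙ k else ℕtoℚ 0)

  -- (1 + (-1)ᵏ) Bₖ is 2 Bₖ + `δ₁ k`. The correction is felt only at k = 1, where its weight is 1 /
  -- (1 · 2).
  2X≡ : 2ℚ · X ≡ T + T + ½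
  2X≡ = begin
    2ℚ · X
      ≡⟨ Σ₁-* r 2ℚ (λ k → if isEven k then bernoulli k ÷ₙ (k * 2 ^ k) else ℕtoℚ 0) ⟨
    Σ₁ r (λ k → 2ℚ · (if isEven k then bernoulli k ÷ₙ (k * 2 ^ k) else ℕtoℚ 0))
      ≡⟨ Σ₁-cong r (λ k _ → term (suc k)) ⟩
    Σ₁ r (λ k → (τ k + τ k) + δ₁ k · (recip k · recip (2 ^ k)))
      ≡⟨ Σ₁-+ r (λ k → τ k + τ k) (λ k → δ₁ k · (recip k · recip (2 ^ k))) ⟩
    Σ₁ r (λ k → τ k + τ k) + Σ₁ r (λ k → δ₁ k · (recip k · recip (2 ^ k)))
      ≡⟨ cong₂ _+_ (Σ₁-+ r τ τ) (Σ₁-δ₁ n (λ k → recip k · recip (2 ^ k))) ⟩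
    T + T + ½ ∎
    where
    open ≡-Reasoning
    τ : ℕ → ℚ
    τ k = modB k ÷ₙ (2 ^ k)
    gather : ∀ s B t u → B · (t · u) + s · (B · (t · u)) ≡ B · t · u + s · B · (t · u)
    gather = solve-∀ ring
    spread : ∀ B δ t u → B · t · u + (B + δ) · (t · u) ≡ (B · t · u + B · t · u) + δ · (t · u)
    spread = solve-∀ ring
    term : ∀ k → 2ℚ · (if isEven k then bernoulli k ÷ₙ (k * 2 ^ k) else ℕtoℚ 0) ≡ (τ k + τ k) + δ₁ k · (recip k · recip (2 ^ k))
    term k = trans (double-even k (bernoulli k ÷ₙ (k * 2 ^ k))) (trans
      (cong (λ y → bernoulli k · y + sgn k · (bernoulli k · y)) (recip-* k (2 ^ k)))
      (trans (gather (sgn k) (bernoulli k) (recip k) (recip (2 ^ k))) (trans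
        (cong (λ y → bernoulli k · recip k · recip (2 ^ k) + y · (recip k · recip (2 ^ k))) (sgn-bernoulli k))
        (spread (bernoulli k) (δ₁ k) (recip k) (recip (2 ^ k))))))

  -- As for `X`, with correction 1 at k = 1. The -1 in the numerators contributes the sum of (1 +
  -- (-1)ᵏ) / k, which is split into a harmonic and an alternating part.
  2Y≡ : 2ℚ · Y ≡ S + S + 1ℚ - (harmonic r + alternating r)
  2Y≡ = begin
    2ℚ · Y
      ≡⟨ Σ₁-* r 2ℚ (λ k → if isEven k then (bernoulli k - 1ℚ) ÷ₙ k else ℕtoℚ 0) ⟨
    Σ₁ r (λ k → 2ℚ · (if isEven k then (bernoulli k - 1ℚ) ÷ₙ k else ℕtoℚ 0))
      ≡⟨ Σ₁-cong r (λ k _ → term (suc k)) ⟩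
    Σ₁ r (λ k → (modB k + modB k) + δ₁ k · recip k + - (recip k + sgn k · recip k))
      ≡⟨ Σ₁-+ r (λ k → (modB k + modB k) + δ₁ k · recip k) (λ k → - (recip k + sgn k · recip k)) ⟩
    Σ₁ r (λ k → (modB k + modB k) + δ₁ k · recip k) + Σ₁ r (λ k → - (recip k + sgn k · recip k))
      ≡⟨ cong₂ _+_ (trans (Σ₁-+ r (λ k → modB k + modB k) (λ k → δ₁ k · recip k)) (cong₂ _+_ (Σ₁-+ r modB modB) (Σ₁-δ₁ n recip)))
           (trans (Σ₁-neg r (λ k → recip k + sgn k · recip k)) (cong -_ (Σ₁-+ r recip (λ k → sgn k · recip k)))) ⟩
    S + S + 1ℚ - (harmonic r + alternating r) ∎
    where
    open ≡-Reasoning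
    gather : ∀ s B t → (B - 1ℚ) · t + s · ((B - 1ℚ) · t) ≡ (B · t + s · B · t) + - (t + s · t)
    gather = solve-∀ ring
    spread : ∀ B δ t → B · t + (B + δ) · t ≡ (B · t + B · t) + δ · t
    spread = solve-∀ ring
    term : ∀ k → 2ℚ · (if isEven k then (bernoulli k - 1ℚ) ÷ₙ k else ℕtoℚ 0)
      ≡ (modB k + modB k) + δ₁ k · recip k + - (recip k + sgn k · recip k)
    term k = trans (double-even k ((bernoulli k - 1ℚ) ÷ₙ k)) (trans (gather (sgn k) (bernoulli k) (recip k))
      (cong (_+ - (recip k + sgn k · recip k)) (trans
        (cong (λ y → bernoulli k · recip k + y · recip k) (sgn-bernoulli k))
        (spread (bernoulli k) (δ₁ k) (recip k)))))

  -- Up to p - 2 the harmonic sum lacks only 1 / (p - 1) ≡ -1, hence is 1; the alternating sum is 1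
  -- - 2 Q by `2Q≈`.
  harmonic+alternating≈ : harmonic r + alternating r ≈ - (2ℚ · Q) + 2ℚ [mod P ]
  harmonic+alternating≈ = begin
    harmonic r + alternating r
      ≡⟨ regroup (harmonic r) (recip q) (alternating r) ⟩
    harmonic q + - recip q + - (- alternating r + 1ℚ) + 1ℚ
      ≈⟨ ≈-+ʳ 1ℚ (≈-+ (≈-+ harmonic-q≈0 (≈-neg recip-q≈)) (≈-neg (≈-sym 2Q≈))) ⟩
    0ℚ + 1ℚ + - (2ℚ · Q) + 1ℚ
      ≡⟨ tidy (- (2ℚ · Q)) ⟩
    - (2ℚ · Q) + 2ℚ ∎
    where
    open SetoidReasoning (≈-setoid P)
    regroup : ∀ H t A → H + A ≡ (H + t) + - t + - (- A + 1ℚ) + 1ℚ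
    regroup = solve-∀ ring
    tidy : ∀ y → 0ℚ + 1ℚ + y + 1ℚ ≡ y + (1ℚ + 1ℚ)
    tidy = solve-∀ ring

  X≈ : X ≈ + 3 / 4 + Y [mod P ]
  X≈ = begin
    X                                                           ≡⟨ halve X ⟩
    ½ · (2ℚ · X)                                            ≡⟨ cong (½ ·_) 2X≡ ⟩
    ½ · (T + T + ½)                                             ≈⟨ ≈-* int-½ (≈-+ʳ ½ (≈-+ T≈Q+S T≈Q+S)) ⟩
    ½ · (Q + S + (Q + S) + ½)                                   ≡⟨ cong (½ ·_) (regroup Q S ½) ⟩
    -- The origin of 3/4: the ½ is the correction at k = 1 in `2X≡`, and the 1 is what the 2 of
    -- `harmonic+alternating≈` exceeds the correction 1 of `2Y≡` by. Their sum is then halved.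
    ½ · (1ℚ + ½ + (S + S + 1ℚ - (- (2ℚ · Q) + 2ℚ)))
      ≈⟨ ≈-* int-½ (≈-+ˡ (1ℚ + ½) (≈-+ˡ (S + S + 1ℚ) (≈-neg (≈-sym harmonic+alternating≈)))) ⟩
    ½ · (1ℚ + ½ + (S + S + 1ℚ - (harmonic r + alternating r)))  ≡⟨ cong (λ y → ½ · (1ℚ + ½ + y)) 2Y≡ ⟨
    ½ · (1ℚ + ½ + 2ℚ · Y)                                   ≡⟨ ℚ.*-distribˡ-+ ½ (1ℚ + ½) (2ℚ · Y) ⟩
    + 3 / 4 + ½ · (2ℚ · Y)                                  ≡⟨ cong (_+_ (+ 3 / 4)) (halve Y) ⟨
    + 3 / 4 + Y                                                 ∎
    where
    open SetoidReasoning (≈-setoid P)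
    halve : ∀ x → x ≡ ½ · (2ℚ · x)
    halve x = sym (trans (sym (ℚ.*-assoc ½ 2ℚ x)) (ℚ.*-identityˡ x))
    T≈Q+S : T ≈ Q + S [mod P ]
    T≈Q+S = ≈-trans T≈ (≈-+ˡ Q (≈-sym S≈))
    regroup : ∀ Q S h → Q + S + (Q + S) + h ≡ 1ℚ + h + (S + S + 1ℚ - (- ((1ℚ + 1ℚ) · Q) + (1ℚ + 1ℚ)))
    regroup = solve-∀ ring

-- Parity of primes and conclusion

⌊n*2/2⌋≡n : ∀ n → ⌊ n * 2 /2⌋ ≡ n
⌊n*2/2⌋≡n zero    = refl
⌊n*2/2⌋≡n (suc n) = cong suc (⌊n*2/2⌋≡n n)

parity : ∀ n → ∃ λ k → (n ≡ k * 2) ⊎ (n ≡ suc (k * 2))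
parity zero = 0 , inj₁ refl
parity (suc n) with parity n
... | k , inj₁ eq = k , inj₂ (cong suc eq)
... | k , inj₂ eq = suc k , inj₁ (cong suc eq)

odd-prime : ∀ {p} → Prime p → p ≢ 2 → ∃ λ g → p ≡ 3 ℕ.+ g * 2
odd-prime {p} p-prime p≢2 with parity p
-- Irreducibility applied to the divisor 2 leaves 2 = 1, which is absurd, or 2 = p.
... | k     , inj₁ refl with prime⇒irreducible p-prime (divides k refl)
...   | inj₂ 2≡p = contradiction (sym 2≡p) p≢2
odd-prime p-prime p≢2 | zero  , inj₂ refl = contradiction p-prime ¬prime[1]
odd-prime p-prime p≢2 | suc g , inj₂ refl = g , refl

theorem6 : (p : ℕ) → Prime p → p ≢ 2 →
    (Σ₁ (p ∸ 2) modB ≡ bernQ p - 1ℚ [modₚ p ])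
    × (bernQ p - 1ℚ ≡ wilsonQ p [modₚ p ])
    × (Σ₁ (p ∸ 2) (λ k → modB k ÷ₙ (2 ^ k)) ≡ fermatQ2 p + wilsonQ p [modₚ p ])
    × (Σ₁ (p ∸ 2) (λ k → modB k ÷ₙ (2 ^ k))
    ≡ - (harmonic ⌊ p ∸ 1 /2⌋ ÷ₙ 2) + bernQ p - 1ℚ [modₚ p ])
    × (Σ₁ (p ∸ 2) (λ k → if isEven k then bernoulli k ÷ₙ (k * 2 ^ k) else ℕtoℚ 0)
    ≡ (+ 3 / 4) + Σ₁ (p ∸ 2) (λ k → if isEven k then (bernoulli k - 1ℚ) ÷ₙ k else ℕtoℚ 0)
    [modₚ p ])
theorem6 p p-prime p≢2 with odd-prime p-prime p≢2
... | g , refl = ≈⇒modₚ S≈ , ≈⇒modₚ (≈-sym W≈) , ≈⇒modₚ T≈Q+W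
  , subst (λ h → T ≡ - (harmonic h ÷ₙ 2) + β - 1ℚ [modₚ p ]) (sym (⌊n*2/2⌋≡n (suc g))) (≈⇒modₚ T≈harmonic)
  , ≈⇒modₚ X≈
  where
  open OddPrime g p-prime hiding (p)
  open Localization (3 ℕ.+ g * 2) p-prime using (≈-sym; ≈⇒modₚ)
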